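{- The sets $\mathcal{B}(x)^{ -1}=\{u^{ -1}:u\in\mathcal{B}(x)\}$, for $x$ ranging over the involutions of $S_n$, are exactly the distinct equivalence classes of $S_n$ under $\sim_{\mathcal{B}}$ (permutations being identified with their one-line sequences $[w(1),\dots,w(n)]$).
   Context: $S_n$ is the Coxeter group with simple generators $s_i=(i,i+1)$ and length $\ell$. The Demazure product $\circ$ is the unique associative operation on $S_n$ with $s\circ w = sw$ if $\ell(sw)>\ell(w)$ and $s\circ w=w$ otherwise, and $w\circ s=ws$ if $\ell(ws)>\ell(w)$ and $w\circ s = w$ otherwise. For an involution $x$, $\mathcal{B}(x)=\{w\in S_n: w^{ -1}\circ w = x\}$ (i.e. $w^{ -1}\circ 1\circ w=x$). The relation $\sim_{\mathcal{B}}$ (the Chinese relation) is the smallest equivalence relation on integer sequences such that $[\cdots,c,a,b,\cdots]\sim_{\mathcal{B}}[\cdots,b,c,a,\cdots]\sim_{\mathcal{B}}[\cdots,c,b,a,\cdots]$ whenever $a\leq b\leq c$, where the displayed triples occupy the same consecutive positions and the sequences agree in all other positions. -}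

module Defs where

open import Data.Nat using (ℕ; zero; suc; _<_; _<ᵇ_)
open import Data.Bool using (Bool; true; false; _∧_; if_then_else_)
open import Data.Fin using (Fin; toℕ; fromℕ<)
open import Data.Fin.Permutation
  using (Permutation′; _⟨$⟩ʳ_; _∘ₚ_; flip; id; transpose; _≈_)
open import Data.Integer using (ℤ; _≤_) renaming (+_ to pos)
open import Data.List using (List; []; _∷_; _++_; map; tabulate; allFin)
open import Data.Nat.ListAction using (sum)
open import Data.Product using (Σ; _×_; _,_; ∃)
open import Relation.Binary.PropositionalEquality using (_≡_)
open import Relation.Nullary using (¬_)
open import Relation.Binary.Construct.Closure.Equivalence using (EqClosure)

-- The symmetric group S_n: permutations of Fin n (= {1,…,n}, 0-based),
-- compared by pointwise equality _≈_ (Data.Fin.Permutation).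
Perm : ℕ → Set
Perm n = Permutation′ n

-- Ordinary product in S_n, in the usual convention (u · v)(k) = u (v k).
infixl 7 _·_
_·_ : ∀ {n} → Perm n → Perm n → Perm n
u · v = v ∘ₚ u

_⁻¹ : ∀ {n} → Perm n → Perm n
w ⁻¹ = flip w

one : ∀ {n} → Perm n
one = id

-- Coxeter length = number of inversions {(i,j) : i < j, w(i) > w(j)}.
ℓ : ∀ {n} → Perm n → ℕ
ℓ {n} w = sum (map (λ i → sum (map (λ j →
    if (toℕ i <ᵇ toℕ j) ∧ (toℕ (w ⟨$⟩ʳ j) <ᵇ toℕ (w ⟨$⟩ʳ i)) then 1 else 0)
      (allFin n))) (allFin n))

s : ∀ {n} (i : Fin n) → suc (toℕ i) < n → Perm n
s i p = transpose i (fromℕ< p)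

IsSimple : ∀ {n} → Perm n → Set
IsSimple {n} t = Σ (Fin n) λ i → Σ (suc (toℕ i) < n) λ p → t ≈ s i p

record IsDemazureProduct {n : ℕ} (_⊙_ : Perm n → Perm n → Perm n) : Set where
  field
    cong⊙   : ∀ {u u′ v v′} → u ≈ u′ → v ≈ v′ → (u ⊙ v) ≈ (u′ ⊙ v′)
    assoc   : ∀ u v w → ((u ⊙ v) ⊙ w) ≈ (u ⊙ (v ⊙ w))
    identityˡ : ∀ w → (one ⊙ w) ≈ w
    identityʳ : ∀ w → (w ⊙ one) ≈ w
    left-up    : ∀ t w → IsSimple t → ℓ w < ℓ (t · w) → (t ⊙ w) ≈ (t · w)
    left-down  : ∀ t w → IsSimple t → ¬ (ℓ w < ℓ (t · w)) → (t ⊙ w) ≈ w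
    right-up   : ∀ t w → IsSimple t → ℓ w < ℓ (w · t) → (w ⊙ t) ≈ (w · t)
    right-down : ∀ t w → IsSimple t → ¬ (ℓ w < ℓ (w · t)) → (w ⊙ t) ≈ w

IsInvolution : ∀ {n} → Perm n → Set
IsInvolution x = (x · x) ≈ one

In𝓑 : ∀ {n} (_⊙_ : Perm n → Perm n → Perm n) → Perm n → Perm n → Set
In𝓑 _⊙_ x w = ((w ⁻¹) ⊙ w) ≈ x

In𝓑⁻¹ : ∀ {n} (_⊙_ : Perm n → Perm n → Perm n) → Perm n → Perm n → Set
In𝓑⁻¹ _⊙_ x u = In𝓑 _⊙_ x (u ⁻¹)

oneLine : ∀ {n} → Perm n → List ℤ
oneLine w = tabulate (λ i → pos (suc (toℕ (w ⟨$⟩ʳ i))))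

data ChStep : List ℤ → List ℤ → Set where
  cab-bca : ∀ (p q : List ℤ) {a b c : ℤ} → a ≤ b → b ≤ c →
    ChStep (p ++ c ∷ a ∷ b ∷ q) (p ++ b ∷ c ∷ a ∷ q)
  bca-cba : ∀ (p q : List ℤ) {a b c : ℤ} → a ≤ b → b ≤ c →
    ChStep (p ++ b ∷ c ∷ a ∷ q) (p ++ c ∷ b ∷ a ∷ q)

_∼𝓑_ : List ℤ → List ℤ → Set
_∼𝓑_ = EqClosure ChStep

{-# OPTIONS --safe #-}
-- Write F u = u ∘ u⁻¹. If u is obtained by putting values a < b < c at three
-- consecutive positions in one of the orders bca, cab, cba, and u₀, t have
-- them in the orders abc, cba, then absorbing simple reflections gives
-- F u = t ∘ u₀⁻¹ in all three cases, so F is constant on ∼𝓑-classes.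
--
-- Conversely, inserting letters from the left (b c a ∼ c a b and c b a ∼ c a b)
-- brings every word to the form b₁ a₁ b₂ a₂ … with aᵢ ≤ bᵢ and a₁ ≤ a₂ ≤ …,
-- where bᵢ is absent if equal to aᵢ. Such a permutation is the list of the
-- cycles (aᵢ bᵢ) of an involution x, and F maps it to x: if i + 1 stands before
-- i, exchanging these two values keeps the form and changes x to s x s, or to
-- s x when (i, i+1) is a cycle, matching the recursion F (s u) = s ∘ F u ∘ s for
-- ascents. As x determines the word, F u = F v implies u ∼𝓑 v.
--
-- Every involution is a value of F by induction on its length, since an
-- involution with descent s is s ∘ y ∘ s with y = s x s or y = s x shorter.
module Submission where

open import Defs
open import Data.Nat using (ℕ)
open import Data.Product using (Σ; _×_)
open import Function.Bundles using (_⇔_; mk⇔)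
open import Data.Bool using (Bool; true; false; _∧_; if_then_else_)
open import Data.Bool.Properties using (∧-comm)
open import Data.Fin using (Fin; zero; suc; toℕ; fromℕ<)
open import Data.Fin.Permutation using (_⟨$⟩ʳ_; _⟨$⟩ˡ_; inverseˡ; inverseʳ; transpose; _≈_)
open import Data.Fin.Properties using (_≟_; toℕ-injective; toℕ<n; toℕ-fromℕ<; any?)
  renaming (suc-injective to Fin-suc-injective)
open import Data.Integer as ℤ using (ℤ) renaming (+_ to pos)
import Data.Integer.Properties as ℤ
open import Data.List using (List; []; _∷_; _++_; map; tabulate; allFin)
open import Data.List.Properties using (map-tabulate; tabulate-cong; ∷-injective)
open import Data.List.Relation.Unary.All as All using (All; []; _∷_)
open import Data.List.Relation.Unary.All.Properties using (tabulate⁻)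
open import Data.Nat as ℕ hiding (ℕ; _≟_)
open import Data.Nat.Induction using (<-wellFounded)
import Data.Nat.ListAction as List
open import Data.Nat.Properties hiding (_≟_)
open import Data.Product using (∃; _,_; proj₁; proj₂)
open import Data.Sum as Sum using (_⊎_; inj₁; inj₂)
open import Data.Unit using (⊤)
open import Function using (_∘_; id; case_of_)
open import Induction.WellFounded using (Acc; acc)
open import Relation.Binary using (Setoid; tri<; tri≈; tri>)
open import Relation.Binary.Construct.Closure.Equivalence as Eq using ()
open import Relation.Binary.Construct.Closure.ReflexiveTransitive using (ε; _◅_; _◅◅_)
open import Relation.Binary.Construct.Closure.Symmetric using (fwd; bwd)
open import Relation.Binary.PropositionalEquality
import Relation.Binary.Reasoning.Setoid as SetoidReasoning
open import Relation.Nullary using (¬_; Dec; yes; no; contradiction)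
open import Relation.Nullary.Decidable using (dec-true; dec-false; _×-dec_)
open import Algebra.Properties.CommutativeMonoid.Sum +-0-commutativeMonoid
  using (sum-cong-≗; ∑-comm; ∑-permute) renaming (sum to ∑)

private variable
  n : ℕ

-- Permutations and finite sums.

to-injective : (w : Perm n) {a b : Fin n} → w ⟨$⟩ʳ a ≡ w ⟨$⟩ʳ b → a ≡ b
to-injective w e = trans (sym (inverseˡ w)) (trans (cong (w ⟨$⟩ˡ_) e) (inverseˡ w))

⁻¹-cong : {u v : Perm n} → u ≈ v → (u ⁻¹) ≈ (v ⁻¹)
⁻¹-cong {u = u} {v} e k = to-injective u
  (trans (inverseʳ u) (trans (sym (inverseʳ v)) (sym (e (v ⟨$⟩ˡ k)))))

involution-⁻¹ : {x : Perm n} → IsInvolution x → x ≈ (x ⁻¹)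
involution-⁻¹ {x = x} inv k = to-injective x (trans (inv k) (sym (inverseʳ x)))

involution-⁻¹-< : {x : Perm n} → IsInvolution x → ∀ {a b} →
  toℕ (x ⟨$⟩ʳ a) < toℕ (x ⟨$⟩ʳ b) → toℕ (x ⟨$⟩ˡ a) < toℕ (x ⟨$⟩ˡ b)
involution-⁻¹-< {x = x} inv {a} {b} =
  subst₂ _<_ (cong toℕ (involution-⁻¹ {x = x} inv a)) (cong toℕ (involution-⁻¹ {x = x} inv b))

≢⇒<⊎> : {a b : Fin n} → a ≢ b → toℕ a < toℕ b ⊎ toℕ b < toℕ a
≢⇒<⊎> {a = a} {b} a≢b with <-cmp (toℕ a) (toℕ b)
... | tri< lt _ _ = inj₁ lt
... | tri≈ _ eq _ = contradiction (toℕ-injective eq) a≢b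
... | tri> _ _ gt = inj₂ gt

∑-mono-≤ : {f g : Fin n → ℕ} → (∀ k → f k ≤ g k) → ∑ f ≤ ∑ g
∑-mono-≤ {zero}  h = z≤n
∑-mono-≤ {suc n} h = +-mono-≤ (h zero) (∑-mono-≤ (h ∘ suc))

∑-mono-< : {f g : Fin n → ℕ} → (∀ k → f k ≤ g k) → (k : Fin n) → f k < g k → ∑ f < ∑ g
∑-mono-< h zero    lt = +-mono-<-≤ lt (∑-mono-≤ (h ∘ suc))
∑-mono-< h (suc k) lt = +-mono-≤-< (h zero) (∑-mono-< (h ∘ suc) k lt)

sum-allFin : (f : Fin n → ℕ) → List.sum (map f (allFin n)) ≡ ∑ f
sum-allFin f = trans (cong List.sum (map-tabulate id f)) (sum-tabulate f)
  where
  sum-tabulate : ∀ {m} (g : Fin m → ℕ) → List.sum (tabulate g) ≡ ∑ g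
  sum-tabulate {zero}  g = refl
  sum-tabulate {suc m} g = cong (g zero +_) (sum-tabulate (g ∘ suc))

-- Length as a count of disagreements between two orderings.

ind : Bool → ℕ
ind b = if b then 1 else 0

discord : (p q : Fin n → Fin n) → Fin n → Fin n → ℕ
discord p q a b = ind ((toℕ (p a) <ᵇ toℕ (p b)) ∧ (toℕ (q b) <ᵇ toℕ (q a)))

-- Unlike the inversion number ℓ w = disagree id w, this is symmetric in its
-- arguments and can be reindexed by a permutation.
disagree : (p q : Fin n → Fin n) → ℕ
disagree p q = ∑ λ a → ∑ (discord p q a)

disagree-cong : {p p′ q q′ : Fin n → Fin n} → p ≗ p′ → q ≗ q′ → disagree p q ≡ disagree p′ q′
disagree-cong {n} e e′ = sum-cong-≗ {n} λ a → sum-cong-≗ {n} λ b →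
  cong₂ (λ c d → ind (c ∧ d)) (cong₂ (λ k l → toℕ k <ᵇ toℕ l) (e a) (e b))
                              (cong₂ (λ k l → toℕ k <ᵇ toℕ l) (e′ b) (e′ a))

disagree-sym : (p q : Fin n → Fin n) → disagree p q ≡ disagree q p
disagree-sym {n} p q = trans (∑-comm (discord p q))
  (sum-cong-≗ {n} λ b → sum-cong-≗ {n} λ a → cong ind (∧-comm (toℕ (p a) <ᵇ toℕ (p b)) _))

disagree-permute : (p q : Fin n → Fin n) (w : Perm n) →
  disagree (p ∘ (w ⟨$⟩ʳ_)) (q ∘ (w ⟨$⟩ʳ_)) ≡ disagree p q
disagree-permute {n} p q w = sym (trans (∑-permute (∑ ∘ discord p q) w)
  (sum-cong-≗ {n} λ a → ∑-permute (discord p q (w ⟨$⟩ʳ a)) w))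

ℓ-disagree : (w : Perm n) → ℓ w ≡ disagree id (w ⟨$⟩ʳ_)
ℓ-disagree {n} w = trans (sum-allFin {n} _)
  (sum-cong-≗ {n} λ a → sum-allFin (discord id (w ⟨$⟩ʳ_) a))

ℓ-cong : {u v : Perm n} → u ≈ v → ℓ u ≡ ℓ v
ℓ-cong {u = u} {v} e = trans (ℓ-disagree u)
  (trans (disagree-cong {p = id} (λ _ → refl) e) (sym (ℓ-disagree v)))

-- Reindexing by `w` turns the disagreement of `id` with the inverse into that of `w` with `id`, and
-- disagreement is symmetric.
ℓ-⁻¹ : (w : Perm n) → ℓ (w ⁻¹) ≡ ℓ w
ℓ-⁻¹ w = begin
  ℓ (w ⁻¹)                                     ≡⟨ ℓ-disagree (w ⁻¹) ⟩
  disagree id (w ⟨$⟩ˡ_)                        ≡⟨ disagree-permute id (w ⟨$⟩ˡ_) w ⟨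
  disagree (w ⟨$⟩ʳ_) ((w ⟨$⟩ˡ_) ∘ (w ⟨$⟩ʳ_))   ≡⟨ disagree-cong {p = w ⟨$⟩ʳ_} (λ _ → refl) (λ _ → inverseˡ w) ⟩
  disagree (w ⟨$⟩ʳ_) id                        ≡⟨ disagree-sym (w ⟨$⟩ʳ_) id ⟩
  disagree id (w ⟨$⟩ʳ_)                        ≡⟨ ℓ-disagree w ⟨
  ℓ w                                          ∎
  where open ≡-Reasoning

<ᵇ-true : ∀ {a b} → a < b → (a <ᵇ b) ≡ true
<ᵇ-true {a} {b} = dec-true (a <? b)

<ᵇ-false : ∀ {a b} → ¬ (a < b) → (a <ᵇ b) ≡ false
<ᵇ-false {a} {b} = dec-false (a <? b)

-- Simple reflections, ascents and descents.

Adjacent : Fin n → Fin n → Set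
Adjacent i j = toℕ j ≡ suc (toℕ i)

module Transposition {n} {i j : Fin n} (i⋖j : Adjacent i j) where

  τ : Perm n
  τ = transpose i j

  i<j : toℕ i < toℕ j
  i<j = ≤-reflexive (sym i⋖j)

  i≢j : i ≢ j
  i≢j refl = <-irrefl refl i<j

  simple : IsSimple τ
  simple = i , subst (_< n) i⋖j (toℕ<n j) , λ k → cong (λ l → transpose i l ⟨$⟩ʳ k)
    (toℕ-injective (trans i⋖j (sym (toℕ-fromℕ< _))))

  τi : τ ⟨$⟩ʳ i ≡ j
  τi rewrite dec-true (i ≟ i) refl = refl

  τj : τ ⟨$⟩ʳ j ≡ i
  τj rewrite dec-false (j ≟ i) (i≢j ∘ sym) | dec-true (j ≟ j) refl = refl

  τ-fix : ∀ {k} → k ≢ i → k ≢ j → τ ⟨$⟩ʳ k ≡ k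
  τ-fix {k} k≢i k≢j rewrite dec-false (k ≟ i) k≢i | dec-false (k ≟ j) k≢j = refl

  data View : Fin n → Set where
    at-i  : View i
    at-j  : View j
    other : ∀ {k} → k ≢ i → k ≢ j → View k

  view : ∀ k → View k
  view k with k ≟ i | k ≟ j
  ... | yes refl | _        = at-i
  ... | no _     | yes refl = at-j
  ... | no k≢i   | no k≢j   = other k≢i k≢j

  τ-involutive : ∀ k → τ ⟨$⟩ʳ (τ ⟨$⟩ʳ k) ≡ k
  τ-involutive k with view k
  ... | at-i rewrite τi = τj
  ... | at-j rewrite τj = τi
  ... | other k≢i k≢j rewrite τ-fix k≢i k≢j = τ-fix k≢i k≢j

  τ⁻¹ : ∀ k → τ ⟨$⟩ˡ k ≡ τ ⟨$⟩ʳ k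
  τ⁻¹ k = to-injective τ (trans (inverseʳ τ) (sym (τ-involutive k)))

  <j⇒<i : ∀ {k : Fin n} → k ≢ i → toℕ k < toℕ j → toℕ k < toℕ i
  <j⇒<i k≢i k<j = ≤∧≢⇒< (s≤s⁻¹ (subst (_ <_) i⋖j k<j)) (k≢i ∘ toℕ-injective)

  i<⇒j< : ∀ {k : Fin n} → k ≢ j → toℕ i < toℕ k → toℕ j < toℕ k
  i<⇒j< k≢j i<k = ≤∧≢⇒< (subst (_≤ _) (sym i⋖j) i<k) (k≢j ∘ sym ∘ toℕ-injective)

  -- No value lies strictly between `i` and `j`, so the pair `(i, j)` itself is the only one that
  -- `τ` can reverse.
  τ-mono-< : ∀ k l → toℕ k < toℕ l → ¬ (k ≡ i × l ≡ j) → toℕ (τ ⟨$⟩ʳ k) < toℕ (τ ⟨$⟩ʳ l)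
  τ-mono-< k l k<l ne with view k | view l
  ... | at-i          | at-i          = contradiction k<l (<-irrefl refl)
  ... | at-i          | at-j          = contradiction (refl , refl) ne
  ... | at-i          | other l≢i l≢j rewrite τi | τ-fix l≢i l≢j = i<⇒j< l≢j k<l
  ... | at-j          | at-i          rewrite τi | τj = i<j
  ... | at-j          | at-j          = contradiction k<l (<-irrefl refl)
  ... | at-j          | other l≢i l≢j rewrite τj | τ-fix l≢i l≢j = <-trans i<j k<l
  ... | other k≢i k≢j | at-i          rewrite τi | τ-fix k≢i k≢j = <-trans k<l i<j
  ... | other k≢i k≢j | at-j          rewrite τj | τ-fix k≢i k≢j = <j⇒<i k≢i k<l
  ... | other k≢i k≢j | other l≢i l≢j rewrite τ-fix k≢i k≢j | τ-fix l≢i l≢j = k<l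

  -- Compared termwise, only the pair `(i, j)` could lose a contribution, and it has none since
  -- `q i < q j`. The pair `(j, i)` gains one.
  disagree-τ : {q : Fin n → Fin n} → toℕ (q i) < toℕ (q j) →
    disagree id q < disagree (τ ⟨$⟩ʳ_) q
  disagree-τ {q} qi<qj = ∑-mono-< (λ a → ∑-mono-≤ (termwise a)) j (∑-mono-< (termwise j) i strict)
    where
    termwise : ∀ a b → ind ((toℕ a <ᵇ toℕ b) ∧ (toℕ (q b) <ᵇ toℕ (q a)))
      ≤ ind ((toℕ (τ ⟨$⟩ʳ a) <ᵇ toℕ (τ ⟨$⟩ʳ b)) ∧ (toℕ (q b) <ᵇ toℕ (q a)))
    termwise a b with toℕ a <? toℕ b | toℕ (q b) <? toℕ (q a)
    ... | no a≮b | _ rewrite <ᵇ-false a≮b = z≤n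
    ... | yes a<b | no qb≮qa rewrite <ᵇ-true a<b | <ᵇ-false qb≮qa = z≤n
    ... | yes a<b | yes qb<qa rewrite <ᵇ-true (τ-mono-< a b a<b (λ { (refl , refl) → <-asym qb<qa qi<qj }))
          | <ᵇ-true a<b | <ᵇ-true qb<qa = ≤-refl

    strict : ind ((toℕ j <ᵇ toℕ i) ∧ (toℕ (q i) <ᵇ toℕ (q j)))
      < ind ((toℕ (τ ⟨$⟩ʳ j) <ᵇ toℕ (τ ⟨$⟩ʳ i)) ∧ (toℕ (q i) <ᵇ toℕ (q j)))
    strict rewrite τi | τj | <ᵇ-false (<-asym i<j) | <ᵇ-true i<j | <ᵇ-true qi<qj = s≤s z≤n

  -- Reindexing by `τ` turns the disagreement of `τ` with `w` into the length of `w · τ`, so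
  -- `disagree-τ` applies.
  ℓ-ascentʳ : (w : Perm n) → toℕ (w ⟨$⟩ʳ i) < toℕ (w ⟨$⟩ʳ j) → ℓ w < ℓ (w · τ)
  ℓ-ascentʳ w wi<wj = subst₂ _<_ (sym (ℓ-disagree w)) eq (disagree-τ wi<wj)
    where
    open ≡-Reasoning
    eq : disagree (τ ⟨$⟩ʳ_) (w ⟨$⟩ʳ_) ≡ ℓ (w · τ)
    eq = begin
      disagree (τ ⟨$⟩ʳ_) (w ⟨$⟩ʳ_)
        ≡⟨ disagree-permute (τ ⟨$⟩ʳ_) (w ⟨$⟩ʳ_) τ ⟨
      disagree ((τ ⟨$⟩ʳ_) ∘ (τ ⟨$⟩ʳ_)) (w · τ ⟨$⟩ʳ_)
        ≡⟨ disagree-cong {q = w · τ ⟨$⟩ʳ_} τ-involutive (λ _ → refl) ⟩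
      disagree id (w · τ ⟨$⟩ʳ_)
        ≡⟨ ℓ-disagree (w · τ) ⟨
      ℓ (w · τ) ∎

  ℓ-descentʳ : (w : Perm n) → toℕ (w ⟨$⟩ʳ j) < toℕ (w ⟨$⟩ʳ i) → ℓ (w · τ) < ℓ w
  ℓ-descentʳ w wj<wi = subst (ℓ (w · τ) <_) (ℓ-cong {u = (w · τ) · τ} {w} (cong (w ⟨$⟩ʳ_) ∘ τ-involutive))
    (ℓ-ascentʳ (w · τ) (subst₂ _<_ (cong (toℕ ∘ (w ⟨$⟩ʳ_)) (sym τi)) (cong (toℕ ∘ (w ⟨$⟩ʳ_)) (sym τj)) wj<wi))

  ℓ-τ· : (w : Perm n) → ℓ (τ · w) ≡ ℓ ((w ⁻¹) · τ)
  ℓ-τ· w = trans (sym (ℓ-⁻¹ (τ · w))) (ℓ-cong {u = (τ · w) ⁻¹} {(w ⁻¹) · τ} (cong (w ⟨$⟩ˡ_) ∘ τ⁻¹))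

  ℓ-ascentˡ : (w : Perm n) → toℕ (w ⟨$⟩ˡ i) < toℕ (w ⟨$⟩ˡ j) → ℓ w < ℓ (τ · w)
  ℓ-ascentˡ w lt = subst₂ _<_ (ℓ-⁻¹ w) (sym (ℓ-τ· w)) (ℓ-ascentʳ (w ⁻¹) lt)

  ℓ-descentˡ : (w : Perm n) → toℕ (w ⟨$⟩ˡ j) < toℕ (w ⟨$⟩ˡ i) → ℓ (τ · w) < ℓ w
  ℓ-descentˡ w lt = subst₂ _<_ (sym (ℓ-τ· w)) (ℓ-⁻¹ w) (ℓ-descentʳ (w ⁻¹) lt)

-- _≈_ wrapped in a record, so that its endpoints can be inferred.
record _≃_ (u v : Perm n) : Set where
  constructor pointwise
  field at : u ≈ v
open _≃_

≃-refl : {u : Perm n} → u ≃ u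
≃-refl .at _ = refl

≃-sym : {u v : Perm n} → u ≃ v → v ≃ u
≃-sym e .at k = sym (at e k)

≃-trans : {u v w : Perm n} → u ≃ v → v ≃ w → u ≃ w
≃-trans e f .at k = trans (at e k) (at f k)

permSetoid : ℕ → Setoid _ _
permSetoid n = record
  { Carrier = Perm n ; _≈_ = _≃_
  ; isEquivalence = record { refl = ≃-refl ; sym = ≃-sym ; trans = ≃-trans } }

-- Demazure products with a simple reflection, and the map `F`.

module Demazure {n} (_⊙_ : Perm n → Perm n → Perm n) (isDemazure : IsDemazureProduct _⊙_) where

  open IsDemazureProduct isDemazure
  open SetoidReasoning (permSetoid n)

  ⊙-cong : ∀ {u u′ v v′} → u ≃ u′ → v ≃ v′ → (u ⊙ v) ≃ (u′ ⊙ v′)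
  ⊙-cong {u} {u′} {v} {v′} e f .at = cong⊙ {u} {u′} {v} {v′} (at e) (at f)

  ⊙-congˡ : ∀ {u v v′} → v ≃ v′ → (u ⊙ v) ≃ (u ⊙ v′)
  ⊙-congˡ = ⊙-cong ≃-refl

  ⊙-congʳ : ∀ {u u′ v} → u ≃ u′ → (u ⊙ v) ≃ (u′ ⊙ v)
  ⊙-congʳ e = ⊙-cong e ≃-refl

  ⊙-assoc : ∀ u v w → ((u ⊙ v) ⊙ w) ≃ (u ⊙ (v ⊙ w))
  ⊙-assoc u v w .at = assoc u v w

  -- `In𝓑⁻¹ _⊙_ x u` says that `F u` is `x`, up to the double inverse of `u`.
  F : Perm n → Perm n
  F u = u ⊙ (u ⁻¹)

  F-cong : ∀ {u v} → u ≃ v → F u ≃ F v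
  F-cong {u} {v} e = ⊙-cong e (pointwise (⁻¹-cong {u = u} {v} (at e)))

  F-one : F one ≃ one
  F-one .at = identityˡ (one ⁻¹)

  module _ {i j : Fin n} (i⋖j : Adjacent i j) where
    open Transposition i⋖j

    ascentʳ : ∀ w → toℕ (w ⟨$⟩ʳ i) < toℕ (w ⟨$⟩ʳ j) → (w ⊙ τ) ≃ (w · τ)
    ascentʳ w lt .at = right-up τ w simple (ℓ-ascentʳ w lt)

    descentʳ : ∀ w → toℕ (w ⟨$⟩ʳ j) < toℕ (w ⟨$⟩ʳ i) → (w ⊙ τ) ≃ w
    descentʳ w lt .at = right-down τ w simple (<-asym (ℓ-descentʳ w lt))

    ascentˡ : ∀ w → toℕ (w ⟨$⟩ˡ i) < toℕ (w ⟨$⟩ˡ j) → (τ ⊙ w) ≃ (τ · w)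
    ascentˡ w lt .at = left-up τ w simple (ℓ-ascentˡ w lt)

    descentˡ : ∀ w → toℕ (w ⟨$⟩ˡ j) < toℕ (w ⟨$⟩ˡ i) → (τ ⊙ w) ≃ w
    descentˡ w lt .at = left-down τ w simple (<-asym (ℓ-descentˡ w lt))

    -- At an ascent the inverse of `w · τ` is the Demazure product `τ ⊙ (w ⁻¹)`, so associativity
    -- hands one reflection from the right factor to the left one.
    ⊙-·τ⁻¹ : ∀ y w → toℕ (w ⟨$⟩ʳ i) < toℕ (w ⟨$⟩ʳ j) →
      (y ⊙ ((w · τ) ⁻¹)) ≃ ((y ⊙ τ) ⊙ (w ⁻¹))
    ⊙-·τ⁻¹ y w lt = begin
      y ⊙ ((w · τ) ⁻¹)   ≈⟨ ⊙-congˡ (pointwise λ k → τ⁻¹ (w ⟨$⟩ˡ k)) ⟩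
      y ⊙ (τ · (w ⁻¹))   ≈⟨ ⊙-congˡ (ascentˡ (w ⁻¹) lt) ⟨
      y ⊙ (τ ⊙ (w ⁻¹))   ≈⟨ ⊙-assoc y τ (w ⁻¹) ⟨
      (y ⊙ τ) ⊙ (w ⁻¹)   ∎

    F-ascent : ∀ u → toℕ (u ⟨$⟩ˡ i) < toℕ (u ⟨$⟩ˡ j) → F (τ · u) ≃ ((τ ⊙ F u) ⊙ τ)
    F-ascent u lt = begin
      (τ · u) ⊙ ((τ · u) ⁻¹)   ≈⟨ ⊙-cong (≃-sym (ascentˡ u lt)) (pointwise λ k → cong (u ⟨$⟩ˡ_) (τ⁻¹ k)) ⟩
      (τ ⊙ u) ⊙ ((u ⁻¹) · τ)   ≈⟨ ⊙-congˡ (ascentʳ (u ⁻¹) lt) ⟨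
      (τ ⊙ u) ⊙ ((u ⁻¹) ⊙ τ)   ≈⟨ ⊙-assoc (τ ⊙ u) (u ⁻¹) τ ⟨
      ((τ ⊙ u) ⊙ (u ⁻¹)) ⊙ τ   ≈⟨ ⊙-congʳ (⊙-assoc τ u (u ⁻¹)) ⟩
      (τ ⊙ F u) ⊙ τ            ∎

    -- At a descent `τ ⊙ u` and `(u ⁻¹) ⊙ τ` both collapse, so Demazure conjugation by `τ` leaves
    -- `F u` unchanged.
    F-descent : ∀ u → toℕ (u ⟨$⟩ˡ j) < toℕ (u ⟨$⟩ˡ i) → F u ≃ ((τ ⊙ F u) ⊙ τ)
    F-descent u lt = begin
      u ⊙ (u ⁻¹)               ≈⟨ ⊙-cong (descentˡ u lt) (descentʳ (u ⁻¹) lt) ⟨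
      (τ ⊙ u) ⊙ ((u ⁻¹) ⊙ τ)   ≈⟨ ⊙-assoc (τ ⊙ u) (u ⁻¹) τ ⟨
      ((τ ⊙ u) ⊙ (u ⁻¹)) ⊙ τ   ≈⟨ ⊙-congʳ (⊙-assoc τ u (u ⁻¹)) ⟩
      (τ ⊙ F u) ⊙ τ            ∎

    module _ (x : Perm n) (inv : IsInvolution x) where

      private
        ascentˡ-inv : toℕ (x ⟨$⟩ʳ i) < toℕ (x ⟨$⟩ʳ j) → (τ ⊙ x) ≃ (τ · x)
        ascentˡ-inv lt = ascentˡ x (involution-⁻¹-< {x = x} inv lt)

      -- Left and right ascents of an involution coincide. After the left multiplication, `τ` still
      -- keeps `x i` below `x j` unless these are `i` and `j` themselves.
      conj-ascent : toℕ (x ⟨$⟩ʳ i) < toℕ (x ⟨$⟩ʳ j) → ¬ (x ⟨$⟩ʳ i ≡ i × x ⟨$⟩ʳ j ≡ j) →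
        ((τ ⊙ x) ⊙ τ) ≃ ((τ · x) · τ)
      conj-ascent lt ne = ≃-trans (⊙-congʳ (ascentˡ-inv lt))
        (ascentʳ (τ · x) (τ-mono-< (x ⟨$⟩ʳ i) (x ⟨$⟩ʳ j) lt ne))

      -- The left multiplication makes `τ · x` swap `i` and `j`, a descent, so the right factor `τ`
      -- is absorbed.
      conj-fixed : x ⟨$⟩ʳ i ≡ i → x ⟨$⟩ʳ j ≡ j → ((τ ⊙ x) ⊙ τ) ≃ (τ · x)
      conj-fixed xi xj = ≃-trans (⊙-congʳ (ascentˡ-inv (subst₂ _<_ (cong toℕ (sym xi)) (cong toℕ (sym xj)) i<j)))
        (descentʳ (τ · x) (subst₂ _<_ (cong toℕ (sym (trans (cong (τ ⟨$⟩ʳ_) xj) τj)))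
                                      (cong toℕ (sym (trans (cong (τ ⟨$⟩ʳ_) xi) τi))) i<j))

-- Chinese triples as products of two simple reflections.

data Arrangement : Set where
  bca cab cba : Arrangement

module Triple {n} {i j k : Fin n} (i⋖j : Adjacent i j) (j⋖k : Adjacent j k) where

  open Transposition i⋖j public using (i<j; i≢j; View; at-i; at-j; other; view)
    renaming (τ to s₁; τi to s₁i; τj to s₁j; τ-fix to s₁-fix)
  open Transposition j⋖k public using ()
    renaming (τ to s₂; τi to s₂j; τj to s₂k; τ-fix to s₂-fix; i<j to j<k; i≢j to j≢k)

  i≢k : i ≢ k
  i≢k refl = <-asym i<j j<k

  s₁k : s₁ ⟨$⟩ʳ k ≡ k
  s₁k = s₁-fix (i≢k ∘ sym) (j≢k ∘ sym)

  s₂i : s₂ ⟨$⟩ʳ i ≡ i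
  s₂i = s₂-fix i≢j i≢k

  -- These act on positions: if `u` reads a, b, c at `i`, `j`, `k`, then `u · arrange t` reads them
  -- in the order named by `t`.
  arrange : Arrangement → Perm n
  arrange bca = s₁ · s₂
  arrange cab = s₂ · s₁
  arrange cba = (s₁ · s₂) · s₁

  braid : ((s₁ · s₂) · s₁) ≃ ((s₂ · s₁) · s₂)
  braid .at l = by-cases (view l) (l ≟ k)
    where
    by-cases : ∀ {l} → View l → Dec (l ≡ k) →
      s₁ ⟨$⟩ʳ (s₂ ⟨$⟩ʳ (s₁ ⟨$⟩ʳ l)) ≡ s₂ ⟨$⟩ʳ (s₁ ⟨$⟩ʳ (s₂ ⟨$⟩ʳ l))
    by-cases at-i _ rewrite s₂i | s₁i | s₂j | s₁k = refl
    by-cases at-j _ rewrite s₁j | s₂i | s₁i | s₂j | s₁k | s₂k = refl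
    by-cases (other l≢i l≢j) (yes refl) rewrite s₁k | s₂k | s₁j | s₂i = refl
    by-cases (other l≢i l≢j) (no l≢k)
      rewrite s₁-fix l≢i l≢j | s₂-fix l≢j l≢k | s₁-fix l≢i l≢j | s₂-fix l≢j l≢k = refl

  module _ (_⊙_ : Perm n → Perm n → Perm n) (isDemazure : IsDemazureProduct _⊙_)
    (u : Perm n) (a<b : toℕ (u ⟨$⟩ʳ i) < toℕ (u ⟨$⟩ʳ j)) (b<c : toℕ (u ⟨$⟩ʳ j) < toℕ (u ⟨$⟩ʳ k)) where

    open Demazure _⊙_ isDemazure
    open SetoidReasoning (permSetoid n)

    private
      a<c : toℕ (u ⟨$⟩ʳ i) < toℕ (u ⟨$⟩ʳ k)
      a<c = <-trans a<b b<c

      top : Perm n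
      top = u · arrange cba

      at₁ : toℕ ((u · s₁) ⟨$⟩ʳ j) < toℕ ((u · s₁) ⟨$⟩ʳ k)
      at₁ rewrite s₁j | s₁k = a<c

      at₂ : toℕ ((u · s₂) ⟨$⟩ʳ i) < toℕ ((u · s₂) ⟨$⟩ʳ j)
      at₂ rewrite s₂i | s₂j = a<c

      at₁₂ : toℕ (((u · s₁) · s₂) ⟨$⟩ʳ i) < toℕ (((u · s₁) · s₂) ⟨$⟩ʳ j)
      at₁₂ rewrite s₂i | s₂j | s₁i | s₁k = b<c

      at₁₂′ : toℕ (((u · s₁) · s₂) ⟨$⟩ʳ k) < toℕ (((u · s₁) · s₂) ⟨$⟩ʳ j)
      at₁₂′ rewrite s₂k | s₂j | s₁j | s₁k = a<c

      at₂₁ : toℕ (((u · s₂) · s₁) ⟨$⟩ʳ j) < toℕ (((u · s₂) · s₁) ⟨$⟩ʳ k)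
      at₂₁ rewrite s₁j | s₁k | s₂i | s₂k = a<b

      at₂₁′ : toℕ (((u · s₂) · s₁) ⟨$⟩ʳ j) < toℕ (((u · s₂) · s₁) ⟨$⟩ʳ i)
      at₂₁′ rewrite s₁j | s₁i | s₂i | s₂j = a<c

      top₁ : toℕ (top ⟨$⟩ʳ j) < toℕ (top ⟨$⟩ʳ i)
      top₁ rewrite s₁j | s₁i | s₂i | s₂j | s₁i | s₁k = b<c

      top₂ : toℕ (top ⟨$⟩ʳ k) < toℕ (top ⟨$⟩ʳ j)
      top₂ rewrite s₁j | s₁k | s₂i | s₂k | s₁i | s₁j = a<b

      -- The reflections of the right factor are handed to the left one by `⊙-·τ⁻¹`. Each is
      -- absorbed at a descent or multiplies at an ascent, until the left factor is `top`.
      F-top : ∀ t → F (u · arrange t) ≃ (top ⊙ (u ⁻¹))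
      F-top bca = begin
        F ((u · s₁) · s₂)
          ≈⟨ ⊙-·τ⁻¹ j⋖k _ (u · s₁) at₁ ⟩
        (((u · s₁) · s₂) ⊙ s₂) ⊙ ((u · s₁) ⁻¹)
          ≈⟨ ⊙-congʳ (descentʳ j⋖k _ at₁₂′) ⟩
        ((u · s₁) · s₂) ⊙ ((u · s₁) ⁻¹)
          ≈⟨ ⊙-·τ⁻¹ i⋖j _ u a<b ⟩
        (((u · s₁) · s₂) ⊙ s₁) ⊙ (u ⁻¹)
          ≈⟨ ⊙-congʳ (ascentʳ i⋖j _ at₁₂) ⟩
        top ⊙ (u ⁻¹) ∎
      F-top cab = begin
        F ((u · s₂) · s₁)
          ≈⟨ ⊙-·τ⁻¹ i⋖j _ (u · s₂) at₂ ⟩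
        (((u · s₂) · s₁) ⊙ s₁) ⊙ ((u · s₂) ⁻¹)
          ≈⟨ ⊙-congʳ (descentʳ i⋖j _ at₂₁′) ⟩
        ((u · s₂) · s₁) ⊙ ((u · s₂) ⁻¹)
          ≈⟨ ⊙-·τ⁻¹ j⋖k _ u b<c ⟩
        (((u · s₂) · s₁) ⊙ s₂) ⊙ (u ⁻¹)
          ≈⟨ ⊙-congʳ (ascentʳ j⋖k _ at₂₁) ⟩
        (((u · s₂) · s₁) · s₂) ⊙ (u ⁻¹)
          -- This case ends with the other reduced word of the reversal of the three positions.
          ≈⟨ ⊙-congʳ (pointwise λ l → cong (u ⟨$⟩ʳ_) (at braid l)) ⟨
        top ⊙ (u ⁻¹) ∎
      F-top cba = begin
        F top
          ≈⟨ ⊙-·τ⁻¹ i⋖j top ((u · s₁) · s₂) at₁₂ ⟩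
        (top ⊙ s₁) ⊙ (((u · s₁) · s₂) ⁻¹)
          ≈⟨ ⊙-congʳ (descentʳ i⋖j top top₁) ⟩
        top ⊙ (((u · s₁) · s₂) ⁻¹)
          ≈⟨ ⊙-·τ⁻¹ j⋖k top (u · s₁) at₁ ⟩
        (top ⊙ s₂) ⊙ ((u · s₁) ⁻¹)
          ≈⟨ ⊙-congʳ (descentʳ j⋖k top top₂) ⟩
        top ⊙ ((u · s₁) ⁻¹)
          ≈⟨ ⊙-·τ⁻¹ i⋖j top u a<b ⟩
        (top ⊙ s₁) ⊙ (u ⁻¹)
          ≈⟨ ⊙-congʳ (descentʳ i⋖j top top₁) ⟩
        top ⊙ (u ⁻¹) ∎

    F-arrange : ∀ t t′ → F (u · arrange t) ≃ F (u · arrange t′)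
    F-arrange t t′ = ≃-trans (F-top t) (≃-sym (F-top t′))

-- Triples of consecutive letters in one-line words.

-- The last component serves to rewrite the three letters while the prefix and the suffix stay in
-- place.
split-tabulate : ∀ {A : Set} (f : Fin n → A) (p : List A) {x y z q} → tabulate f ≡ p ++ x ∷ y ∷ z ∷ q →
  ∃ λ i → ∃ λ j → ∃ λ k → Adjacent i j × Adjacent j k × f i ≡ x × f j ≡ y × f k ≡ z ×
    (∀ g → (∀ l → l ≢ i → l ≢ j → l ≢ k → g l ≡ f l) → tabulate g ≡ p ++ g i ∷ g j ∷ g k ∷ q)
split-tabulate {suc (suc (suc n))} f [] refl = zero , suc zero , suc (suc zero) ,
  refl , refl , refl , refl , refl , λ g e → cong (λ q → _ ∷ _ ∷ _ ∷ q)
    (tabulate-cong λ l → e (suc (suc (suc l))) (λ ()) (λ ()) (λ ()))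
split-tabulate {suc n} f (_ ∷ p) eq with ∷-injective eq
... | refl , eq′ with split-tabulate (f ∘ suc) p eq′
... | i , j , k , i⋖j , j⋖k , fi , fj , fk , update =
  suc i , suc j , suc k , cong suc i⋖j , cong suc j⋖k , fi , fj , fk ,
  λ g e → cong₂ _∷_ (e zero (λ ()) (λ ()) (λ ()))
    (update (g ∘ suc) λ l l≢i l≢j l≢k →
      e (suc l) (l≢i ∘ Fin-suc-injective) (l≢j ∘ Fin-suc-injective) (l≢k ∘ Fin-suc-injective))

letter : Fin n → ℤ
letter v = pos (suc (toℕ v))

letter-injective : {a b : Fin n} → letter a ≡ letter b → a ≡ b
letter-injective e = toℕ-injective (suc-injective (ℤ.+-injective e))

letter-cancel-≤ : {a b : Fin n} → letter a ℤ.≤ letter b → toℕ a ≤ toℕ b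
letter-cancel-≤ le = s≤s⁻¹ (ℤ.drop‿+≤+ le)

tabulate-injective : ∀ {A : Set} {f g : Fin n → A} → tabulate f ≡ tabulate g → ∀ k → f k ≡ g k
tabulate-injective eq zero    = proj₁ (∷-injective eq)
tabulate-injective eq (suc k) = tabulate-injective (proj₂ (∷-injective eq)) k

oneLine-injective : {u v : Perm n} → oneLine u ≡ oneLine v → u ≃ v
oneLine-injective eq .at k = letter-injective (tabulate-injective eq k)

first second third : Arrangement → (a b c : ℤ) → ℤ
first bca a b c = b
first cab a b c = c
first cba a b c = c
second bca a b c = c
second cab a b c = a
second cba a b c = b
third bca a b c = a
third cab a b c = b
third cba a b c = a

triple : Arrangement → (a b c : ℤ) → List ℤ → List ℤ
triple t a b c q = first t a b c ∷ second t a b c ∷ third t a b c ∷ q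

module _ {i j k : Fin n} (i⋖j : Adjacent i j) (j⋖k : Adjacent j k) where

  open Triple i⋖j j⋖k

  arrange-fix : ∀ t {l} → l ≢ i → l ≢ j → l ≢ k → arrange t ⟨$⟩ʳ l ≡ l
  arrange-fix bca l≢i l≢j l≢k rewrite s₂-fix l≢j l≢k = s₁-fix l≢i l≢j
  arrange-fix cab l≢i l≢j l≢k rewrite s₁-fix l≢i l≢j = s₂-fix l≢j l≢k
  arrange-fix cba l≢i l≢j l≢k rewrite s₁-fix l≢i l≢j | s₂-fix l≢j l≢k = s₁-fix l≢i l≢j

  arrange-triple : ∀ t (f : Fin n → ℤ) q →
    f (arrange t ⟨$⟩ʳ i) ∷ f (arrange t ⟨$⟩ʳ j) ∷ f (arrange t ⟨$⟩ʳ k) ∷ q ≡ triple t (f i) (f j) (f k) q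
  arrange-triple bca f q rewrite s₂i | s₂j | s₂k | s₁i | s₁k | s₁j = refl
  arrange-triple cab f q rewrite s₁i | s₁j | s₁k | s₂i | s₂k | s₂j = refl
  arrange-triple cba f q rewrite s₁i | s₁j | s₁k | s₂i | s₂k | s₂j | s₁i | s₁j | s₁k = refl

triple-injective : ∀ t {a b c a′ b′ c′ q q′} → triple t a b c q ≡ triple t a′ b′ c′ q′ →
  a ≡ a′ × b ≡ b′ × c ≡ c′
triple-injective bca refl = refl , refl , refl
triple-injective cab refl = refl , refl , refl
triple-injective cba refl = refl , refl , refl

-- Undoing `arrange t` gives a common base `w`, from which every arrangement of the triple arises in
-- the form that `F-arrange` requires.
sort-triple : ∀ (u : Perm n) p t {a b c q} → oneLine u ≡ p ++ triple t a b c q →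
  ∃ λ i → ∃ λ j → ∃ λ k → Σ (Adjacent i j) λ i⋖j → Σ (Adjacent j k) λ j⋖k →
  let w = u · (Triple.arrange i⋖j j⋖k t ⁻¹) in
  letter (w ⟨$⟩ʳ i) ≡ a × letter (w ⟨$⟩ʳ j) ≡ b × letter (w ⟨$⟩ʳ k) ≡ c ×
  (∀ t′ → oneLine (w · Triple.arrange i⋖j j⋖k t′) ≡ p ++ triple t′ a b c q)
sort-triple {n} u p t {a} {b} {c} {q} eq
  with i , j , k , i⋖j , j⋖k , ui , uj , uk , update ←
    split-tabulate (letter ∘ (u ⟨$⟩ʳ_)) p eq
  = i , j , k , i⋖j , j⋖k , wi , wj , wk , lines
  where
  open Triple i⋖j j⋖k
  open ≡-Reasoning

  w : Perm n
  w = u · (arrange t ⁻¹)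

  f : Fin n → ℤ
  f = letter ∘ (w ⟨$⟩ʳ_)

  w-arrange : ∀ l → f (arrange t ⟨$⟩ʳ l) ≡ letter (u ⟨$⟩ʳ l)
  w-arrange l = cong (letter ∘ (u ⟨$⟩ʳ_)) (inverseˡ (arrange t))

  sorted : f i ≡ a × f j ≡ b × f k ≡ c
  sorted = triple-injective t {q = q} {q} (begin
    triple t (f i) (f j) (f k) q
      ≡⟨ arrange-triple i⋖j j⋖k t f q ⟨
    f (arrange t ⟨$⟩ʳ i) ∷ f (arrange t ⟨$⟩ʳ j) ∷ f (arrange t ⟨$⟩ʳ k) ∷ q
      ≡⟨ cong₂ _∷_ (trans (w-arrange i) ui)
          (cong₂ _∷_ (trans (w-arrange j) uj) (cong (_∷ q) (trans (w-arrange k) uk))) ⟩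
    triple t a b c q ∎)

  wi = proj₁ sorted
  wj = proj₁ (proj₂ sorted)
  wk = proj₂ (proj₂ sorted)

  lines : ∀ t′ → oneLine (w · arrange t′) ≡ p ++ triple t′ a b c q
  lines t′ = begin
    oneLine (w · arrange t′)
      ≡⟨ update (f ∘ (arrange t′ ⟨$⟩ʳ_)) (λ l l≢i l≢j l≢k →
           trans (cong f (trans (arrange-fix i⋖j j⋖k t′ l≢i l≢j l≢k) (sym (arrange-fix i⋖j j⋖k t l≢i l≢j l≢k))))
                 (w-arrange l)) ⟩
    p ++ f (arrange t′ ⟨$⟩ʳ i) ∷ f (arrange t′ ⟨$⟩ʳ j) ∷ f (arrange t′ ⟨$⟩ʳ k) ∷ q
      ≡⟨ cong (p ++_) (arrange-triple i⋖j j⋖k t′ f q) ⟩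
    p ++ triple t′ (f i) (f j) (f k) q
      ≡⟨ cong (p ++_) (cong₂ (λ g r → g r q) (cong₂ (triple t′) wi wj) wk) ⟩
    p ++ triple t′ a b c q ∎

-- Invariance of `F` under the Chinese relation.

module ChineseInvariance (_⊙_ : Perm n → Perm n → Perm n) (isDemazure : IsDemazureProduct _⊙_) where

  open Demazure _⊙_ isDemazure

  rearrange-triple : ∀ (u : Perm n) p t t′ {a b c q} → a ℤ.≤ b → b ℤ.≤ c →
    oneLine u ≡ p ++ triple t a b c q →
    Σ (Perm n) λ v → oneLine v ≡ p ++ triple t′ a b c q × F u ≃ F v
  rearrange-triple u p t t′ {a} {b} {c} {q} a≤b b≤c eq
    with i , j , k , i⋖j , j⋖k , wi , wj , wk , lines ← sort-triple u p t eq
    = w · arrange t′ , lines t′ ,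
      ≃-trans (F-cong (pointwise λ l → cong (u ⟨$⟩ʳ_) (sym (inverseˡ (arrange t)))))
        (F-arrange _⊙_ isDemazure w (strict i≢j (subst₂ ℤ._≤_ (sym wi) (sym wj) a≤b))
           (strict j≢k (subst₂ ℤ._≤_ (sym wj) (sym wk) b≤c)) t t′)
    where
    open Triple i⋖j j⋖k

    w : Perm n
    w = u · (arrange t ⁻¹)

    -- `ChStep` has weak inequalities; they are strict here because the letters of a permutation are
    -- distinct.
    strict : ∀ {k l} → k ≢ l → letter (w ⟨$⟩ʳ k) ℤ.≤ letter (w ⟨$⟩ʳ l) → toℕ (w ⟨$⟩ʳ k) < toℕ (w ⟨$⟩ʳ l)
    strict k≢l le = ≤∧≢⇒< (letter-cancel-≤ le) (k≢l ∘ to-injective w ∘ toℕ-injective)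

  -- `∼𝓑` runs through arbitrary integer lists, so the chain is lifted to permutations one step at a
  -- time, keeping `F` constant.
  ∼-realise : ∀ (u : Perm n) {l} → oneLine u ∼𝓑 l → Σ (Perm n) λ v → oneLine v ≡ l × F u ≃ F v
  ∼-realise u = go u refl
    where
    go : ∀ (u : Perm n) {l l′} → oneLine u ≡ l → l ∼𝓑 l′ → Σ (Perm n) λ v → oneLine v ≡ l′ × F u ≃ F v
    step : ∀ (u : Perm n) p t t′ {a b c q l} → a ℤ.≤ b → b ℤ.≤ c → oneLine u ≡ p ++ triple t a b c q →
      (p ++ triple t′ a b c q) ∼𝓑 l → Σ (Perm n) λ v → oneLine v ≡ l × F u ≃ F v

    go u eq ε = u , eq , ≃-refl
    go u eq (fwd (cab-bca p q a≤b b≤c) ◅ r) = step u p cab bca a≤b b≤c eq r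
    go u eq (bwd (cab-bca p q a≤b b≤c) ◅ r) = step u p bca cab a≤b b≤c eq r
    go u eq (fwd (bca-cba p q a≤b b≤c) ◅ r) = step u p bca cba a≤b b≤c eq r
    go u eq (bwd (bca-cba p q a≤b b≤c) ◅ r) = step u p cba bca a≤b b≤c eq r

    step u p t t′ a≤b b≤c eq r with rearrange-triple u p t t′ a≤b b≤c eq
    ... | v , eq′ , Fu≃Fv with go v eq′ r
    ... | v′ , eq″ , Fv≃Fv′ = v′ , eq″ , ≃-trans Fu≃Fv Fv≃Fv′

  F-∼ : ∀ (u v : Perm n) → oneLine u ∼𝓑 oneLine v → F u ≃ F v
  F-∼ u v r with ∼-realise u r
  ... | v′ , eq , Fu≃Fv′ = ≃-trans Fu≃Fv′ (F-cong (oneLine-injective eq))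

-- Block form of a word.

∷-∼ : ∀ x {l l′} → l ∼𝓑 l′ → (x ∷ l) ∼𝓑 (x ∷ l′)
∷-∼ x = Eq.gmap (x ∷_) λ
  { (cab-bca p q a≤b b≤c) → cab-bca (x ∷ p) q a≤b b≤c
  ; (bca-cba p q a≤b b≤c) → bca-cba (x ∷ p) q a≤b b≤c }

-- The index `m` bounds the lower letter of the next block from below, so the lower letters increase
-- weakly; `single` is a block with its upper letter absent.
data Blocks (m : ℤ) : List ℤ → Set where
  []  : Blocks m []
  single : ∀ {a l} → m ℤ.≤ a → Blocks a l → Blocks m (a ∷ l)
  pair : ∀ {a b l} → m ℤ.≤ a → a ℤ.≤ b → Blocks a l → Blocks m (b ∷ a ∷ l)

-- Before a block `b a` with `a ≤ x`, the larger of `x` and `b` stays in front of `a`. The smaller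
-- moves past `a` and is inserted into the tail, where it respects the bound `a`.
insert-Blocks : ∀ {m} x {l} → m ℤ.≤ x → Blocks m l → ∃ λ l′ → (x ∷ l) ∼𝓑 l′ × Blocks m l′
insert-Blocks x m≤x [] = _ , ε , single m≤x []
insert-Blocks x m≤x (single {a} m≤a bs) with ℤ.≤-total x a
... | inj₁ x≤a = _ , ε , single m≤x (single x≤a bs)
... | inj₂ a≤x = _ , ε , pair m≤a a≤x bs
insert-Blocks x m≤x (pair {a} {b} m≤a a≤b bs) with ℤ.≤-total x a | ℤ.≤-total x b
... | inj₁ x≤a | _ = _ , ε , single m≤x (pair x≤a a≤b bs)
... | inj₂ a≤x | inj₁ x≤b with insert-Blocks x a≤x bs
...   | _ , r , bs′ = _ , bwd (cab-bca [] _ a≤x x≤b) ◅ ∷-∼ b (∷-∼ a r) , pair m≤a a≤b bs′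
insert-Blocks x m≤x (pair {a} {b} m≤a a≤b bs) | inj₂ a≤x | inj₂ b≤x with insert-Blocks b a≤b bs
...   | _ , r , bs′ = _ , bwd (bca-cba [] _ a≤b b≤x) ◅ bwd (cab-bca [] _ a≤b b≤x) ◅ ∷-∼ x (∷-∼ a r) ,
                      pair m≤a a≤x bs′

Blocks-weaken : ∀ {m m′ l} → m′ ℤ.≤ m → Blocks m l → Blocks m′ l
Blocks-weaken le []              = []
Blocks-weaken le (single m≤a bs)     = single (ℤ.≤-trans le m≤a) bs
Blocks-weaken le (pair m≤a a≤b bs) = pair (ℤ.≤-trans le m≤a) a≤b bs

∼-Blocks : ∀ l → ∃ λ m → ∃ λ l′ → l ∼𝓑 l′ × Blocks m l′
∼-Blocks [] = pos 0 , [] , ε , []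
∼-Blocks (x ∷ l) with ∼-Blocks l
... | m , l′ , r , bs with insert-Blocks x (ℤ.i⊓j≤j m x) (Blocks-weaken (ℤ.i⊓j≤i m x) bs)
... | l″ , r′ , bs′ = m ℤ.⊓ x , l″ , ∷-∼ x r ◅◅ r′ , bs′

-- This consequence of the block form is preserved when the values i and
-- i + 1 are exchanged (PairDominated-τ), and it is all that the induction needs.
PairDominated : List ℤ → Set
PairDominated (x ∷ y ∷ l) = All (λ z → x ℤ.≤ z ⊎ y ℤ.≤ z) l × PairDominated (y ∷ l)
PairDominated _           = ⊤

Blocks-bound : ∀ {m l} → Blocks m l → All (m ℤ.≤_) l
Blocks-bound []              = []
Blocks-bound (single m≤a bs)     = m≤a ∷ All.map (ℤ.≤-trans m≤a) (Blocks-bound bs)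
Blocks-bound (pair m≤a a≤b bs) =
  ℤ.≤-trans m≤a a≤b ∷ m≤a ∷ All.map (ℤ.≤-trans m≤a) (Blocks-bound bs)

minimum∷-PairDominated : ∀ {a l} → All (a ℤ.≤_) l → PairDominated l → PairDominated (a ∷ l)
minimum∷-PairDominated []       _  = _
minimum∷-PairDominated (_ ∷ le) pd = All.map inj₁ le , pd

-- Any two adjacent letters include the lower letter of a block, and this is at most everything
-- after it.
Blocks⇒PairDominated : ∀ {m l} → Blocks m l → PairDominated l
Blocks⇒PairDominated []             = _
Blocks⇒PairDominated (single _ bs)     = minimum∷-PairDominated (Blocks-bound bs) (Blocks⇒PairDominated bs)
Blocks⇒PairDominated (pair _ _ bs)   = All.map inj₂ (Blocks-bound bs) ,
  minimum∷-PairDominated (Blocks-bound bs) (Blocks⇒PairDominated bs)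

PairDominated-tabulate : (f : Fin n → ℤ) → PairDominated (tabulate f) →
  ∀ p q r → Adjacent p q → toℕ q < toℕ r → f p ℤ.≤ f r ⊎ f q ℤ.≤ f r
PairDominated-tabulate {suc (suc n)} f (le , _) zero (suc zero) (suc (suc r)) p⋖q q<r = tabulate⁻ le r
PairDominated-tabulate {suc (suc n)} f _ zero (suc zero) (suc zero) p⋖q q<r = contradiction q<r (<-irrefl refl)
PairDominated-tabulate {suc (suc n)} f (_ , pd) (suc p) (suc q) (suc r) p⋖q q<r =
  PairDominated-tabulate (f ∘ suc) pd p q r (suc-injective p⋖q) (s≤s⁻¹ q<r)
PairDominated-tabulate {suc zero} f _ zero zero _ () _

PairDominatedPerm : Perm n → Set
PairDominatedPerm u = ∀ p q r → Adjacent p q → toℕ q < toℕ r →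
  toℕ (u ⟨$⟩ʳ p) ≤ toℕ (u ⟨$⟩ʳ r) ⊎ toℕ (u ⟨$⟩ʳ q) ≤ toℕ (u ⟨$⟩ʳ r)

-- Permutations without descents.

increasing-≥ : (f : Fin n → ℕ) → (∀ i j → Adjacent i j → f i < f j) → ∀ k → toℕ k ≤ f k
increasing-≥ {suc n} f inc k = ≤-trans (m≤n+m (toℕ k) (f zero)) (shifted f inc k)
  where
  -- Keeping `f zero` in the bound lets the induction pass to `f ∘ suc`, whose first value is at
  -- least one larger.
  shifted : ∀ {m} (f : Fin (suc m) → ℕ) → (∀ i j → Adjacent i j → f i < f j) → ∀ k → f zero + toℕ k ≤ f k
  shifted f inc zero = ≤-reflexive (+-identityʳ (f zero))
  shifted {suc m} f inc (suc k) = begin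
    f zero + suc (toℕ k)   ≡⟨ +-suc (f zero) (toℕ k) ⟩
    suc (f zero) + toℕ k   ≤⟨ +-monoˡ-≤ (toℕ k) (inc zero (suc zero) refl) ⟩
    f (suc zero) + toℕ k   ≤⟨ shifted (f ∘ suc) (λ i j e → inc (suc i) (suc j) (cong suc e)) k ⟩
    f (suc k)              ∎
    where open ≤-Reasoning

-- w k ≥ k for all k, and the two sides have the same sum.
increasing⇒one : (w : Perm n) → (∀ i j → Adjacent i j → toℕ (w ⟨$⟩ʳ i) < toℕ (w ⟨$⟩ʳ j)) → w ≃ one
increasing⇒one w inc .at k with m≤n⇒m<n∨m≡n (increasing-≥ (toℕ ∘ (w ⟨$⟩ʳ_)) inc k)
... | inj₁ k<wk = contradiction (∑-permute toℕ w)
  (<⇒≢ (∑-mono-< (increasing-≥ (toℕ ∘ (w ⟨$⟩ʳ_)) inc) k k<wk))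
... | inj₂ k≡wk = sym (toℕ-injective k≡wk)

descent? : (w : Perm n) → (∃ λ i → ∃ λ j → Adjacent i j × toℕ (w ⟨$⟩ʳ j) < toℕ (w ⟨$⟩ʳ i)) ⊎ w ≃ one
descent? w with any? (λ i → any? (λ j → (toℕ j ℕ.≟ suc (toℕ i)) ×-dec (toℕ (w ⟨$⟩ʳ j) <? toℕ (w ⟨$⟩ʳ i))))
... | yes descent = inj₁ descent
... | no none = inj₂ (increasing⇒one w inc)
  where
  inc : ∀ i j → Adjacent i j → toℕ (w ⟨$⟩ʳ i) < toℕ (w ⟨$⟩ʳ j)
  inc i j i⋖j with ≢⇒<⊎> (Transposition.i≢j i⋖j ∘ to-injective w)
  ... | inj₁ lt = lt
  ... | inj₂ gt = contradiction (i , j , i⋖j , gt) none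

-- Cycle words of involutions.

module _ (x : Perm n) where

  -- For an involution, the least element of the cycle of `v`.
  lower : Fin n → Fin n
  lower v with toℕ v ≤? toℕ (x ⟨$⟩ʳ v)
  ... | yes _ = v
  ... | no  _ = x ⟨$⟩ʳ v

  lower-≤ : ∀ {v} → toℕ v ≤ toℕ (x ⟨$⟩ʳ v) → lower v ≡ v
  lower-≤ {v} le with toℕ v ≤? toℕ (x ⟨$⟩ʳ v)
  ... | yes _ = refl
  ... | no ≰ = contradiction le ≰

  lower-≥ : ∀ {v} → toℕ (x ⟨$⟩ʳ v) ≤ toℕ v → lower v ≡ x ⟨$⟩ʳ v
  lower-≥ {v} ge with toℕ v ≤? toℕ (x ⟨$⟩ʳ v)
  ... | yes le = toℕ-injective (≤-antisym le ge)
  ... | no _ = refl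

  lower≤ˡ : ∀ v → toℕ (lower v) ≤ toℕ v
  lower≤ˡ v with toℕ v ≤? toℕ (x ⟨$⟩ʳ v)
  ... | yes _ = ≤-refl
  ... | no ≰ = ≰⇒≥ ≰

  lower≤ʳ : ∀ v → toℕ (lower v) ≤ toℕ (x ⟨$⟩ʳ v)
  lower≤ʳ v with toℕ v ≤? toℕ (x ⟨$⟩ʳ v)
  ... | yes le = le
  ... | no _ = ≤-refl

  lower-or : ∀ v → lower v ≡ v ⊎ lower v ≡ x ⟨$⟩ʳ v
  lower-or v with toℕ v ≤? toℕ (x ⟨$⟩ʳ v)
  ... | yes _ = inj₁ refl
  ... | no _ = inj₂ refl

  -- The order of the letters in the word b₁ a₁ b₂ a₂ … listing the cycles
  -- (aᵢ bᵢ), aᵢ ≤ bᵢ, of an involution x by increasing aᵢ.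
  Precedes : Fin n → Fin n → Set
  Precedes v w = toℕ (lower v) < toℕ (lower w) ⊎ (lower v ≡ lower w × toℕ w < toℕ v)

  Precedes-asym : ∀ {v w} → Precedes v w → ¬ Precedes w v
  Precedes-asym (inj₁ lt)       (inj₁ gt)       = <-asym lt gt
  Precedes-asym (inj₁ lt)       (inj₂ (eq , _)) = <-irrefl (cong toℕ (sym eq)) lt
  Precedes-asym (inj₂ (eq , _)) (inj₁ gt)       = <-irrefl (cong toℕ (sym eq)) gt
  Precedes-asym (inj₂ (_ , lt)) (inj₂ (_ , gt)) = <-asym lt gt

  IsCycleWord : Perm n → Set
  IsCycleWord u = ∀ p r → toℕ p < toℕ r → Precedes (u ⟨$⟩ʳ p) (u ⟨$⟩ʳ r)

lower-cong : {x y : Perm n} → x ≃ y → ∀ v → lower x v ≡ lower y v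
lower-cong {x = x} {y} e v with ≤-total (toℕ v) (toℕ (x ⟨$⟩ʳ v))
... | inj₁ le = trans (lower-≤ x le) (sym (lower-≤ y (subst (λ k → _ ≤ toℕ k) (at e v) le)))
... | inj₂ ge = trans (lower-≥ x ge) (trans (at e v) (sym (lower-≥ y (subst (λ k → toℕ k ≤ _) (at e v) ge))))

IsCycleWord-cong : {x y u : Perm n} → x ≃ y → IsCycleWord x u → IsCycleWord y u
IsCycleWord-cong {x = x} {y} {u} e cw p r p<r
  with cw p r p<r | lower-cong e (u ⟨$⟩ʳ p) | lower-cong e (u ⟨$⟩ʳ r)
... | c | eq | eq′ rewrite eq | eq′ = c

-- Both words list the letters in the asymmetric order `Precedes x`, so `(v ⁻¹) · u` has no descent
-- and is the identity.
IsCycleWord-unique : {x u v : Perm n} → IsCycleWord x u → IsCycleWord x v → u ≃ v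
IsCycleWord-unique {x = x} {u} {v} cu cv .at k =
  trans (sym (inverseʳ v)) (cong (v ⟨$⟩ʳ_) (at (increasing⇒one ((v ⁻¹) · u) inc) k))
  where
  inc : ∀ i j → Adjacent i j → toℕ (v ⟨$⟩ˡ (u ⟨$⟩ʳ i)) < toℕ (v ⟨$⟩ˡ (u ⟨$⟩ʳ j))
  inc i j i⋖j with ≢⇒<⊎> (Transposition.i≢j i⋖j ∘ to-injective ((v ⁻¹) · u))
  ... | inj₁ lt = lt
  ... | inj₂ gt = contradiction
    (subst₂ (Precedes x) (inverseʳ v) (inverseʳ v) (cv _ _ gt))
    (Precedes-asym x (cu i j (Transposition.i<j i⋖j)))

-- Exchanging two consecutive values in a word.

module _ {i j : Fin n} (i⋖j : Adjacent i j) where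

  open Transposition i⋖j

  -- An inequality between two letters could be reversed only if `i` stood before `j` in `u`,
  -- whereas `j` comes first.
  PairDominated-τ : (u : Perm n) → toℕ (u ⟨$⟩ˡ j) < toℕ (u ⟨$⟩ˡ i) →
    PairDominatedPerm u → PairDominatedPerm (τ · u)
  PairDominated-τ u j-before-i dom p q r p⋖q q<r =
    Sum.map (τ-≤ p (<-trans (Transposition.i<j p⋖q) q<r)) (τ-≤ q q<r) (dom p q r p⋖q q<r)
    where
    τ-≤ : ∀ p → toℕ p < toℕ r → toℕ (u ⟨$⟩ʳ p) ≤ toℕ (u ⟨$⟩ʳ r) →
      toℕ (τ ⟨$⟩ʳ (u ⟨$⟩ʳ p)) ≤ toℕ (τ ⟨$⟩ʳ (u ⟨$⟩ʳ r))
    τ-≤ p p<r le = <⇒≤ (τ-mono-< _ _ (≤∧≢⇒< le λ e → <-irrefl (cong toℕ (to-injective u (toℕ-injective e))) p<r)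
      λ (up≡i , ur≡j) → <-asym p<r (subst₂ (λ k l → toℕ k < toℕ l)
        (trans (cong (u ⟨$⟩ˡ_) (sym ur≡j)) (inverseˡ u))
        (trans (cong (u ⟨$⟩ˡ_) (sym up≡i)) (inverseˡ u)) j-before-i))

  module CycleWordStep (x u v : Perm n) (x-inv : IsInvolution x)
    (u≡τv : ∀ p → u ⟨$⟩ʳ p ≡ τ ⟨$⟩ʳ (v ⟨$⟩ʳ p))
    (i-before-j : toℕ (v ⟨$⟩ˡ i) < toℕ (v ⟨$⟩ˡ j))
    (dom : PairDominatedPerm u) (cw : IsCycleWord x v) where

    private
      τu≡v : ∀ p → τ ⟨$⟩ʳ (u ⟨$⟩ʳ p) ≡ v ⟨$⟩ʳ p
      τu≡v p = trans (cong (τ ⟨$⟩ʳ_) (u≡τv p)) (τ-involutive _)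

      p₀ r₀ : Fin n
      p₀ = v ⟨$⟩ˡ i
      r₀ = v ⟨$⟩ˡ j

      ur₀ : u ⟨$⟩ʳ r₀ ≡ i
      ur₀ = trans (u≡τv r₀) (trans (cong (τ ⟨$⟩ʳ_) (inverseʳ v)) τj)

      small : ∀ q → toℕ (u ⟨$⟩ʳ q) ≤ toℕ (u ⟨$⟩ʳ r₀) → q ≢ r₀ → toℕ (v ⟨$⟩ʳ q) < toℕ i
      small q le q≢r₀ = subst (λ k → toℕ k < toℕ i) uq≡vq uq<i
        where
        uq<i : toℕ (u ⟨$⟩ʳ q) < toℕ i
        uq<i = subst (λ k → toℕ (u ⟨$⟩ʳ q) < toℕ k) ur₀ (≤∧≢⇒< le (q≢r₀ ∘ to-injective u ∘ toℕ-injective))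
        uq≡vq : u ⟨$⟩ʳ q ≡ v ⟨$⟩ʳ q
        uq≡vq = trans (sym (τ-fix (λ e → <-irrefl (cong toℕ e) uq<i)
                                  (λ e → <-irrefl (cong toℕ e) (<-trans uq<i i<j)))) (τu≡v q)

      -- Otherwise cycle order makes the letters of `v` at `q` and at the next position at least
      -- `i`, while domination in `u` at `r₀`, where `u` has the value `i`, makes one of them
      -- smaller.
      no-i-block : ∀ q → suc (toℕ q) < toℕ r₀ → ¬ lower x (v ⟨$⟩ʳ q) ≡ i
      no-i-block q 1+q<r₀ eq = case dom q q′ r₀ q⋖q′ q′<r₀ of λ
        { (inj₁ le) → <⇒≱ (small q le λ { refl → <-asym 1+q<r₀ (n<1+n _) })
            (subst (λ k → toℕ k ≤ toℕ (v ⟨$⟩ʳ q)) eq (lower≤ˡ x _))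
        ; (inj₂ le) → <⇒≱ (small q′ le λ { e → <-irrefl (cong toℕ e) q′<r₀ })
            (≤-trans (subst (λ k → toℕ k ≤ toℕ (lower x (v ⟨$⟩ʳ q′))) eq later) (lower≤ˡ x _)) }
        where
        q′ = fromℕ< (<-trans 1+q<r₀ (toℕ<n r₀))
        q⋖q′ : Adjacent q q′
        q⋖q′ = toℕ-fromℕ< (<-trans 1+q<r₀ (toℕ<n r₀))
        q′<r₀ : toℕ q′ < toℕ r₀
        q′<r₀ = subst (_< toℕ r₀) (sym q⋖q′) 1+q<r₀
        later : toℕ (lower x (v ⟨$⟩ʳ q)) ≤ toℕ (lower x (v ⟨$⟩ʳ q′))
        later with cw q q′ (Transposition.i<j q⋖q′)
        ... | inj₁ lt = <⇒≤ lt
        ... | inj₂ (e , _) = ≤-reflexive (cong toℕ e)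

      position-< : ∀ a b → a ≢ b → ¬ Precedes x b a → toℕ (v ⟨$⟩ˡ a) < toℕ (v ⟨$⟩ˡ b)
      position-< a b a≢b b⊀a with ≢⇒<⊎> (a≢b ∘ to-injective (v ⁻¹))
      ... | inj₁ lt = lt
      ... | inj₂ gt = contradiction (subst₂ (Precedes x) (inverseʳ v) (inverseʳ v) (cw _ _ gt)) b⊀a

      -- Within a cycle the larger letter comes first, so `i` before `j` puts them in different
      -- cycles.
      lower-i<j : toℕ (lower x i) < toℕ (lower x j)
      lower-i<j with subst₂ (Precedes x) (inverseʳ v) (inverseʳ v) (cw p₀ r₀ i-before-j)
      ... | inj₁ lt = lt
      ... | inj₂ (_ , j<i) = contradiction j<i (<-asym i<j)

      lower-x : ∀ a → toℕ a ≤ toℕ (x ⟨$⟩ʳ a) → lower x (x ⟨$⟩ʳ a) ≡ a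
      lower-x a le = trans (lower-≥ x (subst (λ k → toℕ k ≤ toℕ (x ⟨$⟩ʳ a)) (sym (x-inv a)) le)) (x-inv a)

      larger-precedes : ∀ a → toℕ a < toℕ (x ⟨$⟩ʳ a) → toℕ (v ⟨$⟩ˡ (x ⟨$⟩ʳ a)) < toℕ (v ⟨$⟩ˡ a)
      larger-precedes a a<xa = position-< (x ⟨$⟩ʳ a) a (λ e → <-irrefl (cong toℕ (sym e)) a<xa) λ
        { (inj₁ lt) → <-irrefl (cong toℕ (trans (lower-≤ x (<⇒≤ a<xa)) (sym (lower-x a (<⇒≤ a<xa))))) lt
        ; (inj₂ (_ , xa<a)) → <-asym a<xa xa<a }

    -- The excluded case is that i and j are both least in their cycles: then v
    -- reads … (x i) i … j … or … i … (x j) … j …, contradicting no-i-block.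
    fixed-or-ascent : (x ⟨$⟩ʳ i ≡ i × x ⟨$⟩ʳ j ≡ j) ⊎
      (toℕ (x ⟨$⟩ʳ i) < toℕ i × toℕ (x ⟨$⟩ʳ i) < toℕ (x ⟨$⟩ʳ j))
    fixed-or-ascent with <-cmp (toℕ (x ⟨$⟩ʳ i)) (toℕ i)
    ... | tri< xi<i _ _ = inj₂ (xi<i , ≤-trans
            (subst (λ k → toℕ k < toℕ (lower x j)) (lower-≥ x (<⇒≤ xi<i)) lower-i<j) (lower≤ʳ x j))
    ... | tri> _ _ i<xi = contradiction
            (trans (cong (lower x) (inverseʳ v)) (lower-x i (<⇒≤ i<xi)))
            (no-i-block (v ⟨$⟩ˡ (x ⟨$⟩ʳ i)) (<-≤-trans (s≤s (larger-precedes i i<xi)) i-before-j))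
    ... | tri≈ _ xi≡i _ with <-cmp (toℕ (x ⟨$⟩ʳ j)) (toℕ j)
    -- Here `i = lower x i < lower x j ≤ x j < j`, impossible for consecutive values.
    ...   | tri< xj<j _ _ = contradiction
              (i<⇒j< (λ e → <-irrefl (cong toℕ e) xj<j)
                (≤-trans (subst (λ k → toℕ k < toℕ (lower x j)) (lower-≤ x (≤-reflexive (sym xi≡i))) lower-i<j)
                         (lower≤ʳ x j)))
              (<-asym xj<j)
    ...   | tri≈ _ xj≡j _ = inj₁ (toℕ-injective xi≡i , toℕ-injective xj≡j)
    ...   | tri> _ _ j<xj = contradiction
              (trans (cong (lower x) (inverseʳ v)) (lower-≤ x (≤-reflexive (sym xi≡i))))
              (no-i-block p₀ (≤-trans (s≤s i-before-xj) (larger-precedes j j<xj)))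
      where
      i-before-xj : toℕ (v ⟨$⟩ˡ i) < toℕ (v ⟨$⟩ˡ (x ⟨$⟩ʳ j))
      i-before-xj = position-< i (x ⟨$⟩ʳ j) (λ e → <-asym i<j (subst (λ k → toℕ j < toℕ k) (sym e) j<xj)) λ
        { (inj₁ lt) → <-asym i<j (subst₂ _<_ (cong toℕ (lower-x j (<⇒≤ j<xj)))
                                             (cong toℕ (lower-≤ x (≤-reflexive (sym xi≡i)))) lt)
        ; (inj₂ (e , _)) → i≢j (trans (sym (lower-≤ x (≤-reflexive (sym xi≡i))))
                                       (trans (sym e) (lower-x j (<⇒≤ j<xj)))) }

    transport : ∀ y → (∀ a b → Precedes x a b → Precedes y (τ ⟨$⟩ʳ a) (τ ⟨$⟩ʳ b)) → IsCycleWord y u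
    transport y h p r p<r = subst₂ (Precedes y) (sym (u≡τv p)) (sym (u≡τv r)) (h _ _ (cw p r p<r))

    -- `τ` carries the cycles of `x` to those of the conjugate. It keeps the order of the least
    -- elements, as `i` is not one of them, and the order within a cycle, as `i` and `j` lie in
    -- different cycles.
    conjugate-cycleWord : toℕ (x ⟨$⟩ʳ i) < toℕ i → IsCycleWord ((τ · x) · τ) u
    conjugate-cycleWord xi<i = transport y precedes
      where
      y : Perm n
      y = (τ · x) · τ

      yτ : ∀ a → y ⟨$⟩ʳ (τ ⟨$⟩ʳ a) ≡ τ ⟨$⟩ʳ (x ⟨$⟩ʳ a)
      yτ a = cong (λ k → τ ⟨$⟩ʳ (x ⟨$⟩ʳ k)) (τ-involutive a)

      xi≢j : x ⟨$⟩ʳ i ≢ j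
      xi≢j e = <-asym i<j (subst (λ k → toℕ k < toℕ i) e xi<i)

      lower-y : ∀ a → lower y (τ ⟨$⟩ʳ a) ≡ τ ⟨$⟩ʳ (lower x a)
      lower-y a with <-cmp (toℕ a) (toℕ (x ⟨$⟩ʳ a))
      ... | tri< lt _ _ = trans (lower-≤ y (subst (λ k → _ ≤ toℕ k) (sym (yτ a))
                (<⇒≤ (τ-mono-< a (x ⟨$⟩ʳ a) lt λ { (refl , e) → xi≢j e }))))
              (cong (τ ⟨$⟩ʳ_) (sym (lower-≤ x (<⇒≤ lt))))
      ... | tri≈ _ eq _ = trans (lower-≤ y (≤-reflexive (cong toℕ (trans (cong (τ ⟨$⟩ʳ_) (toℕ-injective eq)) (sym (yτ a))))))
              (cong (τ ⟨$⟩ʳ_) (sym (lower-≤ x (≤-reflexive eq))))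
      ... | tri> _ _ gt = trans (lower-≥ y (subst (λ k → toℕ k ≤ _) (sym (yτ a))
                (<⇒≤ (τ-mono-< (x ⟨$⟩ʳ a) a gt λ { (e , refl) → xi≢j (trans (cong (x ⟨$⟩ʳ_) (sym e)) (x-inv j)) }))))
              (trans (yτ a) (cong (τ ⟨$⟩ʳ_) (sym (lower-≥ x (<⇒≤ gt)))))

      lower≢i : ∀ a → lower x a ≢ i
      lower≢i a e with lower-or x a
      ... | inj₁ e′ = <⇒≱ xi<i (subst₂ (λ k l → toℕ k ≤ toℕ (x ⟨$⟩ʳ l)) e (trans (sym e′) e) (lower≤ʳ x a))
      ... | inj₂ e′ = <⇒≱ xi<i (subst₂ (λ k l → toℕ k ≤ toℕ l) e
              (trans (sym (x-inv a)) (cong (x ⟨$⟩ʳ_) (trans (sym e′) e))) (lower≤ˡ x a))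

      precedes : ∀ a b → Precedes x a b → Precedes y (τ ⟨$⟩ʳ a) (τ ⟨$⟩ʳ b)
      precedes a b (inj₁ lt) = inj₁ (subst₂ _<_ (cong toℕ (sym (lower-y a))) (cong toℕ (sym (lower-y b)))
        (τ-mono-< _ _ lt (λ (e , _) → lower≢i a e)))
      precedes a b (inj₂ (e , b<a)) = inj₂
        ( trans (lower-y a) (trans (cong (τ ⟨$⟩ʳ_) e) (sym (lower-y b)))
        , τ-mono-< b a b<a λ { (refl , refl) → <-irrefl (cong toℕ (sym e)) lower-i<j })

    -- The one-letter blocks `i` and `j` of `x` merge into the block `j i` of `τ · x`; the other
    -- blocks keep their least elements, which are neither `i` nor `j`.
    merge-cycleWord : x ⟨$⟩ʳ i ≡ i → x ⟨$⟩ʳ j ≡ j → IsCycleWord (τ · x) u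
    merge-cycleWord xi xj = transport y λ a b → precedes (view a) (view b)
      where
      y : Perm n
      y = τ · x

      x-fix : ∀ {a c} → x ⟨$⟩ʳ c ≡ c → a ≢ c → x ⟨$⟩ʳ a ≢ c
      x-fix xc a≢c e = a≢c (to-injective x (trans e (sym xc)))

      lower-fixed : ∀ {c} → x ⟨$⟩ʳ c ≡ c → lower x c ≡ c
      lower-fixed xc = lower-≤ x (≤-reflexive (cong toℕ (sym xc)))

      lower≢ : ∀ {a c} → x ⟨$⟩ʳ c ≡ c → a ≢ c → lower x a ≢ c
      lower≢ {a} xc a≢c e with lower-or x a
      ... | inj₁ e′ = a≢c (trans (sym e′) e)
      ... | inj₂ e′ = x-fix xc a≢c (trans (sym e′) e)

      lower-τi : lower y (τ ⟨$⟩ʳ i) ≡ i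
      lower-τi rewrite τi = trans (lower-≥ y (subst (λ k → toℕ k ≤ toℕ j) (sym yj) (<⇒≤ i<j))) yj
        where
        yj : y ⟨$⟩ʳ j ≡ i
        yj = trans (cong (τ ⟨$⟩ʳ_) xj) τj

      lower-τj : lower y (τ ⟨$⟩ʳ j) ≡ i
      lower-τj rewrite τj = lower-≤ y (subst (λ k → toℕ i ≤ toℕ k) (sym (trans (cong (τ ⟨$⟩ʳ_) xi) τi)) (<⇒≤ i<j))

      lower-τ : ∀ {a} → a ≢ i → a ≢ j → lower y (τ ⟨$⟩ʳ a) ≡ lower x a
      lower-τ {a} a≢i a≢j rewrite τ-fix a≢i a≢j = by-cases
        where
        ya : y ⟨$⟩ʳ a ≡ x ⟨$⟩ʳ a
        ya = τ-fix (x-fix xi a≢i) (x-fix xj a≢j)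
        by-cases : lower y a ≡ lower x a
        by-cases with ≤-total (toℕ a) (toℕ (x ⟨$⟩ʳ a))
        ... | inj₁ le = trans (lower-≤ y (subst (λ k → toℕ a ≤ toℕ k) (sym ya) le)) (sym (lower-≤ x le))
        ... | inj₂ ge = trans (lower-≥ y (subst (λ k → toℕ k ≤ toℕ a) (sym ya) ge))
          (trans ya (sym (lower-≥ x ge)))

      precedes : ∀ {a b} → View a → View b → Precedes x a b → Precedes y (τ ⟨$⟩ʳ a) (τ ⟨$⟩ʳ b)
      precedes at-i at-i (inj₁ lt) = contradiction lt (<-irrefl refl)
      precedes at-i at-i (inj₂ (_ , lt)) = contradiction lt (<-irrefl refl)
      precedes at-j at-j (inj₁ lt) = contradiction lt (<-irrefl refl)
      precedes at-j at-j (inj₂ (_ , lt)) = contradiction lt (<-irrefl refl)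
      precedes at-j at-i c = contradiction c (Precedes-asym x (inj₁ lower-i<j))
      precedes at-i at-j c = inj₂ (trans lower-τi (sym lower-τj) , subst₂ _<_ (cong toℕ (sym τj)) (cong toℕ (sym τi)) i<j)
      precedes at-i (other b≢i b≢j) (inj₁ lt) rewrite lower-τi | lower-τ b≢i b≢j | lower-fixed xi = inj₁ lt
      precedes at-i (other b≢i b≢j) (inj₂ (e , _)) = contradiction (trans (sym e) (lower-fixed xi)) (lower≢ xi b≢i)
      precedes at-j (other b≢i b≢j) (inj₁ lt) rewrite lower-τj | lower-τ b≢i b≢j | lower-fixed xj = inj₁ (<-trans i<j lt)
      precedes at-j (other b≢i b≢j) (inj₂ (e , _)) = contradiction (trans (sym e) (lower-fixed xj)) (lower≢ xj b≢j)
      precedes (other a≢i a≢j) at-i (inj₁ lt) rewrite lower-τi | lower-τ a≢i a≢j | lower-fixed xi = inj₁ lt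
      precedes (other a≢i a≢j) at-i (inj₂ (e , _)) = contradiction (trans e (lower-fixed xi)) (lower≢ xi a≢i)
      -- The least element of the cycle of `j` drops to `i`; one below `j` and different from `i` is
      -- still below it.
      precedes (other a≢i a≢j) at-j (inj₁ lt) rewrite lower-τj | lower-τ a≢i a≢j | lower-fixed xj =
        inj₁ (<j⇒<i (lower≢ xi a≢i) lt)
      precedes (other a≢i a≢j) at-j (inj₂ (e , _)) = contradiction (trans e (lower-fixed xj)) (lower≢ xj a≢j)
      precedes (other a≢i a≢j) (other b≢i b≢j) c
        rewrite lower-τ a≢i a≢j | lower-τ b≢i b≢j | τ-fix a≢i a≢j | τ-fix b≢i b≢j = c

-- Involutions obtained from an involution and a simple reflection.

module _ {i j : Fin n} (i⋖j : Adjacent i j) (x : Perm n) (x-inv : IsInvolution x) where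

  open Transposition i⋖j

  conjugate-involution : IsInvolution ((τ · x) · τ)
  conjugate-involution k = trans (cong (λ l → τ ⟨$⟩ʳ (x ⟨$⟩ʳ l)) (τ-involutive _))
    (trans (cong (τ ⟨$⟩ʳ_) (x-inv _)) (τ-involutive k))

  τ·-involution : (∀ k → x ⟨$⟩ʳ (τ ⟨$⟩ʳ k) ≡ τ ⟨$⟩ʳ (x ⟨$⟩ʳ k)) → IsInvolution (τ · x)
  τ·-involution commute k = trans (cong (τ ⟨$⟩ʳ_) (commute _)) (trans (τ-involutive _) (x-inv k))

  fixed-commute : x ⟨$⟩ʳ i ≡ i → x ⟨$⟩ʳ j ≡ j → ∀ k → x ⟨$⟩ʳ (τ ⟨$⟩ʳ k) ≡ τ ⟨$⟩ʳ (x ⟨$⟩ʳ k)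
  fixed-commute xi xj k = by-cases (view k)
    where
    by-cases : ∀ {k} → View k → x ⟨$⟩ʳ (τ ⟨$⟩ʳ k) ≡ τ ⟨$⟩ʳ (x ⟨$⟩ʳ k)
    by-cases at-i rewrite τi | xi | τi = xj
    by-cases at-j rewrite τj | xj | τj = xi
    by-cases (other k≢i k≢j) rewrite τ-fix k≢i k≢j = sym (τ-fix
      (λ e → k≢i (to-injective x (trans e (sym xi)))) (λ e → k≢j (to-injective x (trans e (sym xj)))))

  swapped-commute : x ⟨$⟩ʳ i ≡ j → x ⟨$⟩ʳ j ≡ i → ∀ k → x ⟨$⟩ʳ (τ ⟨$⟩ʳ k) ≡ τ ⟨$⟩ʳ (x ⟨$⟩ʳ k)
  swapped-commute xi xj k = by-cases (view k)
    where
    by-cases : ∀ {k} → View k → x ⟨$⟩ʳ (τ ⟨$⟩ʳ k) ≡ τ ⟨$⟩ʳ (x ⟨$⟩ʳ k)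
    by-cases at-i rewrite τi | xi | τj = xj
    by-cases at-j rewrite τj | xj | τi = xi
    by-cases (other k≢i k≢j) rewrite τ-fix k≢i k≢j = sym (τ-fix
      (λ e → k≢j (to-injective x (trans e (sym xj)))) (λ e → k≢i (to-injective x (trans e (sym xi)))))

IsCycleWord-one : {u : Perm n} → u ≃ one → IsCycleWord one u
IsCycleWord-one {u = u} e p r p<r = inj₁ (subst₂ _<_ (lower-one p) (lower-one r) p<r)
  where
  lower-one : ∀ p → toℕ p ≡ toℕ (lower one (u ⟨$⟩ʳ p))
  lower-one p = cong toℕ (trans (sym (at e p)) (sym (lower-≤ one ≤-refl)))

⁻¹≃one : {u : Perm n} → (u ⁻¹) ≃ one → u ≃ one
⁻¹≃one {u = u} e .at k = trans (cong (u ⟨$⟩ʳ_) (sym (at e k))) (inverseʳ u)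

-- Values and fibres of `F`.

module Classification {n} (_⊙_ : Perm n → Perm n → Perm n) (isDemazure : IsDemazureProduct _⊙_) where

  open Demazure _⊙_ isDemazure
  open ChineseInvariance _⊙_ isDemazure

  -- Induction on `ℓ u`: domination is passed down to the shorter `τ · u`, and the involution and
  -- its cycle word are rebuilt on the way back by `CycleWordStep`.
  F-cycleWord : (u : Perm n) → PairDominatedPerm u →
    Σ (Perm n) λ x → IsInvolution x × IsCycleWord x u × F u ≃ x
  F-cycleWord u = go u (<-wellFounded (ℓ u))
    where
    go : ∀ u → Acc _<_ (ℓ u) → PairDominatedPerm u →
      Σ (Perm n) λ x → IsInvolution x × IsCycleWord x u × F u ≃ x
    go u (acc rec) dom with descent? (u ⁻¹)
    ... | inj₂ u⁻¹≃one = one , (λ _ → refl) , IsCycleWord-one u≃one , ≃-trans (F-cong u≃one) F-one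
      where
      u≃one = ⁻¹≃one u⁻¹≃one
    -- A descent of `u ⁻¹` means that the value `j` stands before the value `i` in `u`.
    ... | inj₁ (i , j , i⋖j , j-before-i) = extend (go v (rec (ℓ-descentˡ u j-before-i)) (PairDominated-τ i⋖j u j-before-i dom))
      where
      open Transposition i⋖j

      v : Perm n
      v = τ · u

      τv≃u : (τ · v) ≃ u
      τv≃u .at k = τ-involutive (u ⟨$⟩ʳ k)

      i-before-j : toℕ (v ⟨$⟩ˡ i) < toℕ (v ⟨$⟩ˡ j)
      i-before-j = subst₂ _<_ (cong (toℕ ∘ (u ⟨$⟩ˡ_)) (sym (trans (τ⁻¹ i) τi)))
                              (cong (toℕ ∘ (u ⟨$⟩ˡ_)) (sym (trans (τ⁻¹ j) τj))) j-before-i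

      extend : (Σ (Perm n) λ x → IsInvolution x × IsCycleWord x v × F v ≃ x) →
        Σ (Perm n) λ x → IsInvolution x × IsCycleWord x u × F u ≃ x
      extend (x , x-inv , cw , Fv≃x) = case fixed-or-ascent of λ
        { (inj₁ (xi , xj)) → τ · x , τ·-involution i⋖j x x-inv (fixed-commute i⋖j x x-inv xi xj) ,
            merge-cycleWord xi xj , ≃-trans Fu (conj-fixed i⋖j x x-inv xi xj)
        ; (inj₂ (xi<i , xi<xj)) → (τ · x) · τ , conjugate-involution i⋖j x x-inv ,
            conjugate-cycleWord xi<i ,
            ≃-trans Fu (conj-ascent i⋖j x x-inv xi<xj λ (e , _) → <-irrefl (cong toℕ e) xi<i) }
        where
        open CycleWordStep i⋖j x u v x-inv (λ p → sym (at τv≃u p)) i-before-j dom cw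

        Fu : F u ≃ ((τ ⊙ x) ⊙ τ)
        Fu = ≃-trans (F-cong (≃-sym τv≃u)) (≃-trans (F-ascent i⋖j v i-before-j) (⊙-congʳ (⊙-congˡ Fv≃x)))

  ∼-cycleWord : (u : Perm n) → Σ (Perm n) λ w → Σ (Perm n) λ x →
    oneLine u ∼𝓑 oneLine w × IsInvolution x × IsCycleWord x w × F u ≃ x
  ∼-cycleWord u with ∼-Blocks (oneLine u)
  ... | _ , l , u∼l , blocks with ∼-realise u u∼l
  ... | w , refl , Fu≃Fw with F-cycleWord w (λ p q r p⋖q q<r → Sum.map letter-cancel-≤ letter-cancel-≤
          (PairDominated-tabulate _ (Blocks⇒PairDominated blocks) p q r p⋖q q<r))
  ... | x , x-inv , cw , Fw≃x = w , x , u∼l , x-inv , cw , ≃-trans Fu≃Fw Fw≃x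

  F-involutive : (u : Perm n) → Σ (Perm n) λ x → IsInvolution x × F u ≃ x
  F-involutive u with ∼-cycleWord u
  ... | _ , x , _ , x-inv , _ , Fu≃x = x , x-inv , Fu≃x

  -- The cycle words equivalent to `u` and `v` belong to the same involution, so they coincide.
  F-injective-∼ : (u v : Perm n) → F u ≃ F v → oneLine u ∼𝓑 oneLine v
  F-injective-∼ u v Fu≃Fv with ∼-cycleWord u | ∼-cycleWord v
  ... | w , x , u∼w , _ , cw , Fu≃x | w′ , x′ , v∼w′ , _ , cw′ , Fv≃x′ =
    u∼w ◅◅ subst (_∼𝓑 oneLine v) (oneLine-cong (≃-sym w≃w′)) (Eq.symmetric ChStep v∼w′)
    where
    x≃x′ : x ≃ x′
    x≃x′ = ≃-trans (≃-sym Fu≃x) (≃-trans Fu≃Fv Fv≃x′)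

    w≃w′ : w ≃ w′
    w≃w′ = IsCycleWord-unique (IsCycleWord-cong {u = w} x≃x′ cw) cw′

    oneLine-cong : {u v : Perm n} → u ≃ v → oneLine u ≡ oneLine v
    oneLine-cong e = tabulate-cong λ k → cong letter (at e k)

  -- At an ascent the witness is `τ · v`; at a descent `F v` is already fixed by the conjugation.
  conj-surjective : ∀ {i j} (i⋖j : Adjacent i j) (v : Perm n) → let open Transposition i⋖j in
    Σ (Perm n) λ u → F u ≃ ((τ ⊙ F v) ⊙ τ)
  conj-surjective i⋖j v with ≢⇒<⊎> (Transposition.i≢j i⋖j ∘ to-injective (v ⁻¹))
  ... | inj₁ lt = _ , F-ascent i⋖j v lt
  ... | inj₂ gt = v , F-descent i⋖j v gt

  F-surjective : (x : Perm n) → IsInvolution x → Σ (Perm n) λ u → F u ≃ x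
  F-surjective x = go x (<-wellFounded (ℓ x))
    where
    go : ∀ x → Acc _<_ (ℓ x) → IsInvolution x → Σ (Perm n) λ u → F u ≃ x
    go x (acc rec) x-inv with descent? x
    ... | inj₂ x≃one = one , ≃-trans F-one (≃-sym x≃one)
    ... | inj₁ (i , j , i⋖j , xj<xi) with (x ⟨$⟩ʳ i) ≟ j
    -- Here `x` swaps `i` and `j`, so `τ · x` is an involution fixing both, and `conj-fixed` leads
    -- back to `x`.
    ...   | yes xi≡j = extend (go (τ · x) (rec ℓτx<ℓx) τx-inv)
      where
      open Transposition i⋖j

      ℓτx<ℓx : ℓ (τ · x) < ℓ x
      ℓτx<ℓx = ℓ-descentˡ x (involution-⁻¹-< {x = x} x-inv xj<xi)

      xj≡i : x ⟨$⟩ʳ j ≡ i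
      xj≡i = trans (cong (x ⟨$⟩ʳ_) (sym xi≡j)) (x-inv i)

      τx-inv : IsInvolution (τ · x)
      τx-inv = τ·-involution i⋖j x x-inv (swapped-commute i⋖j x x-inv xi≡j xj≡i)

      extend : (Σ (Perm n) λ v → F v ≃ (τ · x)) → Σ (Perm n) λ u → F u ≃ x
      extend (v , Fv) with conj-surjective i⋖j v
      ... | u , Fu = u , ≃-trans Fu (≃-trans (⊙-congʳ (⊙-congˡ Fv)) (≃-trans
        (conj-fixed i⋖j (τ · x) τx-inv (trans (cong (τ ⟨$⟩ʳ_) xi≡j) τj) (trans (cong (τ ⟨$⟩ʳ_) xj≡i) τi))
        (pointwise λ k → τ-involutive (x ⟨$⟩ʳ k))))
    -- As `x` does not swap `i` and `j`, both multiplications by `τ` shorten `x`, and `conj-ascent`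
    -- leads back from the conjugate.
    ...   | no xi≢j = extend (go y (rec (<-trans ℓy<ℓτx ℓτx<ℓx)) y-inv)
      where
      open Transposition i⋖j

      y : Perm n
      y = (τ · x) · τ

      y-inv : IsInvolution y
      y-inv = conjugate-involution i⋖j x x-inv

      τxj<τxi : toℕ (τ ⟨$⟩ʳ (x ⟨$⟩ʳ j)) < toℕ (τ ⟨$⟩ʳ (x ⟨$⟩ʳ i))
      τxj<τxi = τ-mono-< _ _ xj<xi λ (_ , xi≡j) → xi≢j xi≡j

      ℓτx<ℓx : ℓ (τ · x) < ℓ x
      ℓτx<ℓx = ℓ-descentˡ x (involution-⁻¹-< {x = x} x-inv xj<xi)

      ℓy<ℓτx : ℓ y < ℓ (τ · x)
      ℓy<ℓτx = ℓ-descentʳ (τ · x) τxj<τxi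

      yi<yj : toℕ (y ⟨$⟩ʳ i) < toℕ (y ⟨$⟩ʳ j)
      yi<yj rewrite τi | τj = τxj<τxi

      not-fixed : ¬ (y ⟨$⟩ʳ i ≡ i × y ⟨$⟩ʳ j ≡ j)
      not-fixed (yi , yj) = <-asym i<j (subst₂ (λ k l → toℕ k < toℕ l) xj≡j xi≡i xj<xi)
        where
        xj≡j : x ⟨$⟩ʳ j ≡ j
        xj≡j = to-injective τ (trans (trans (cong (λ k → τ ⟨$⟩ʳ (x ⟨$⟩ʳ k)) (sym τi)) yi) (sym τj))
        xi≡i : x ⟨$⟩ʳ i ≡ i
        xi≡i = to-injective τ (trans (trans (cong (λ k → τ ⟨$⟩ʳ (x ⟨$⟩ʳ k)) (sym τj)) yj) (sym τi))

      extend : (Σ (Perm n) λ v → F v ≃ y) → Σ (Perm n) λ u → F u ≃ x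
      extend (v , Fv) with conj-surjective i⋖j v
      ... | u , Fu = u , ≃-trans Fu (≃-trans (⊙-congʳ (⊙-congˡ Fv)) (≃-trans
        (conj-ascent i⋖j y y-inv yi<yj not-fixed)
        (pointwise λ k → trans (τ-involutive _) (cong (x ⟨$⟩ʳ_) (τ-involutive k)))))

-- Fibres of `F` as Chinese classes.

theorem6p5 : (n : ℕ) (_⊙_ : Perm n → Perm n → Perm n) → IsDemazureProduct _⊙_ →
    ((x : Perm n) → IsInvolution x → Σ (Perm n) λ u → In𝓑⁻¹ _⊙_ x u)
    × ((x : Perm n) → IsInvolution x → (u v : Perm n) → In𝓑⁻¹ _⊙_ x u →
    (In𝓑⁻¹ _⊙_ x v ⇔ (oneLine u ∼𝓑 oneLine v)))
    × ((u : Perm n) → Σ (Perm n) λ x → IsInvolution x × In𝓑⁻¹ _⊙_ x u)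
theorem6p5 n _⊙_ isDemazure = surjective , (λ x _ u v u∈ → mk⇔
    (λ v∈ → F-injective-∼ u v (≃-trans (F≃ {x} u u∈) (≃-sym (F≃ v v∈))))
    (λ u∼v → ∈𝓑⁻¹ {x} v (≃-trans (≃-sym (F-∼ u v u∼v)) (F≃ {x} u u∈)))) , involutive
  where
  open Demazure _⊙_ isDemazure
  open ChineseInvariance _⊙_ isDemazure
  open Classification _⊙_ isDemazure

  unflip : ∀ u → (((u ⁻¹) ⁻¹) ⊙ (u ⁻¹)) ≃ F u
  unflip u = ⊙-congʳ (pointwise λ _ → refl)

  F≃ : ∀ {x} u → In𝓑⁻¹ _⊙_ x u → F u ≃ x
  F≃ u u∈ = ≃-trans (≃-sym (unflip u)) (pointwise u∈)

  ∈𝓑⁻¹ : ∀ {x} u → F u ≃ x → In𝓑⁻¹ _⊙_ x u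
  ∈𝓑⁻¹ u Fu≃x = at (≃-trans (unflip u) Fu≃x)

  surjective : (x : Perm n) → IsInvolution x → Σ (Perm n) λ u → In𝓑⁻¹ _⊙_ x u
  surjective x x-inv with F-surjective x x-inv
  ... | u , Fu≃x = u , ∈𝓑⁻¹ u Fu≃x

  involutive : (u : Perm n) → Σ (Perm n) λ x → IsInvolution x × In𝓑⁻¹ _⊙_ x u
  involutive u with F-involutive u
  ... | x , x-inv , Fu≃x = x , x-inv , ∈𝓑⁻¹ u Fu≃x
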